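{- Let $m\ge1$ and let $\epsilon=(\epsilon_1,\dots,\epsilon_s)$ be a circular sequence of integers, not all zero. If $\epsilon'$ is the circular sequence obtained from $\epsilon$ by removing all zero entries, then $c(\Gamma^m_\epsilon)=c(\Gamma^m_{\epsilon'})$ and $\ell(\Gamma^m_\epsilon)=\ell(\Gamma^m_{\epsilon'})$.
   Context: Digraph $\Gamma^m_\epsilon$ of a circular integer sequence $\epsilon=(\epsilon_1,\dots,\epsilon_s)$ (indices mod $s$): vertices $x_{i,t}$, $0\le i\le m-1$, $t\in\{1,\dots,s\}$, some "marked zero". If $s=1$: if $\epsilon_1\ne0$ all vertices are marked zero and there are no edges; if $\epsilon_1=0$ nothing is marked and each $x_{i,1}$ carries a loop of weight $0$. If $s\ge2$: for each $t$ let $A_t=\max(\epsilon_t,0)$, $B_t=\max(-\epsilon_{t+1},0)$; for each $j\in\{0,\dots,m-1\}$: if $j\ge\max(A_t,B_t)$ add an edge from $x_{j-A_t,t}$ to $x_{j-B_t,t+1}$ of weight $A_t-B_t$; if $A_t\le j<B_t$ mark $x_{j-A_t,t}$ zero; if $B_t\le j<A_t$ mark $x_{j-B_t,t+1}$ zero. Each connected component is a directed path (linear digraph, possibly a single vertex) or a directed cycle (circular digraph); a linear digraph with no vertex marked zero is a free linear digraph. $\ell(\cdot)$ = number of free linear digraphs, $c(\cdot)$ = number of circular digraphs. -}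

module Defs where

open import Data.Bool using (Bool; true; false; _∧_; _∨_; not; if_then_else_)
open import Data.Nat using (ℕ; zero; suc; _≡ᵇ_; _<ᵇ_; _∸_; _%_; _≤ᵇ_)
open import Data.Integer using (ℤ; +_; -[1+_]; _-_)
open import Data.List using (List; []; _∷_; _++_; length; map; concatMap; filterᵇ; upTo; foldr)
open import Data.Bool.ListAction using (any; all)
open import Data.Product using (_×_; _,_; proj₁; proj₂)

-- The sequence ε = (ε_1,…,ε_s) is a list of length s; position t ∈ {1..s}
-- of the paper is index t-1 ∈ {0..s-1} here; indices are taken mod s.

entry : List ℤ → ℕ → ℤ
entry []       _       = + 0
entry (x ∷ xs) zero    = x
entry (x ∷ xs) (suc n) = entry xs n

-- ε_t with t taken modulo s (for s = 0 returns 0, never used)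
at : List ℤ → ℕ → ℤ
at ε t with length ε
... | zero  = + 0
... | suc k = entry ε (t % suc k)

isZero : ℤ → Bool
isZero (+ zero)  = true
isZero (+ suc _) = false
isZero -[1+ _ ]  = false

nonzero : ℤ → Bool
nonzero x = not (isZero x)

pos : ℤ → ℕ
pos (+ n)    = n
pos -[1+ n ] = 0

neg : ℤ → ℕ
neg (+ n)    = 0
neg -[1+ n ] = suc n

-- vertices x_{i,t} : the pair (i , t) with 0 ≤ i < m, 0 ≤ t < s (0-based t)
Vertex : Set
Vertex = ℕ × ℕ

eqV : Vertex → Vertex → Bool
eqV (a , b) (c , d) = (a ≡ᵇ c) ∧ (b ≡ᵇ d)

-- weighted edge: source, target, weight
Edge : Set
Edge = Vertex × Vertex × ℤ

record Digraph : Set where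
  field
    vertices : List Vertex
    edges    : List Edge          -- with multiplicity
    marked   : List Vertex
open Digraph public

edgeAt : List ℤ → ℕ → ℕ → List Edge
edgeAt ε t j =
  let A = pos (at ε t) ; B = neg (at ε (suc t)) ; t' = suc t % suc (length ε ∸ 1) in
  if (A ≤ᵇ j) ∧ (B ≤ᵇ j)
    then (((j ∸ A) , t) , ((j ∸ B) , t') , (+ A - + B)) ∷ []
    else []

markAt : List ℤ → ℕ → ℕ → List Vertex
markAt ε t j =
  let A = pos (at ε t) ; B = neg (at ε (suc t)) ; t' = suc t % suc (length ε ∸ 1) in
  (if (A ≤ᵇ j) ∧ (j <ᵇ B) then ((j ∸ A) , t) ∷ [] else [])
  ++ (if (B ≤ᵇ j) ∧ (j <ᵇ A) then ((j ∸ B) , t') ∷ [] else [])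

allVertices : ℕ → ℕ → List Vertex
allVertices m s = concatMap (λ i → map (λ t → (i , t)) (upTo s)) (upTo m)

Γ : ℕ → List ℤ → Digraph
Γ m []          = record { vertices = [] ; edges = [] ; marked = [] }
Γ m (e ∷ []) with isZero e
... | true  = record { vertices = allVertices m 1
                     ; edges    = map (λ i → ((i , 0) , (i , 0) , + 0)) (upTo m)
                     ; marked   = [] }
... | false = record { vertices = allVertices m 1
                     ; edges    = []
                     ; marked   = allVertices m 1 }
Γ m ε@(_ ∷ _ ∷ _) =
  record { vertices = allVertices m (length ε)
         ; edges    = concatMap (λ t → concatMap (edgeAt ε t) (upTo m)) (upTo (length ε))
         ; marked   = concatMap (λ t → concatMap (markAt ε t) (upTo m)) (upTo (length ε)) }

_∈ᵇ_ : Vertex → List Vertex → Bool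
v ∈ᵇ S = any (eqV v) S

neighbours : Digraph → Vertex → List Vertex
neighbours G v = concatMap f (edges G)
  where
  f : Edge → List Vertex
  f (a , b , _) = (if eqV a v then b ∷ [] else []) ++ (if eqV b v then a ∷ [] else [])

step : Digraph → List Vertex → List Vertex
step G S = foldr (λ u acc → if u ∈ᵇ acc then acc else u ∷ acc) S (concatMap (neighbours G) S)

iter : ℕ → (List Vertex → List Vertex) → List Vertex → List Vertex
iter zero    f S = S
iter (suc n) f S = iter n f (f S)

-- the connected component of v: |V| closure steps suffice
component : Digraph → Vertex → List Vertex
component G v = iter (length (vertices G)) (step G) (v ∷ [])

representatives : Digraph → List Vertex
representatives G = go [] (vertices G)
  where
  go : List Vertex → List Vertex → List Vertex
  go seen []       = []
  go seen (v ∷ vs) = if any (_∈ᵇ component G v) seen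
                       then go (v ∷ seen) vs
                       else v ∷ go (v ∷ seen) vs

count : {A : Set} → (A → Bool) → List A → ℕ
count p xs = length (filterᵇ p xs)

outdeg indeg : Digraph → Vertex → ℕ
outdeg G v = count (λ e → eqV (proj₁ e) v) (edges G)
indeg  G v = count (λ e → eqV (proj₁ (proj₂ e)) v) (edges G)

-- a connected component C is a circular digraph (directed cycle) iff
-- every vertex has in-degree 1 and out-degree 1
isCircular : Digraph → List Vertex → Bool
isCircular G C = all (λ v → (outdeg G v ≡ᵇ 1) ∧ (indeg G v ≡ᵇ 1)) C

-- a connected component C is a linear digraph (directed path, possibly a
-- single vertex) iff all in/out-degrees are ≤ 1 and some vertex has
-- in-degree 0
isLinear : Digraph → List Vertex → Bool
isLinear G C = all (λ v → (outdeg G v ≤ᵇ 1) ∧ (indeg G v ≤ᵇ 1)) C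
             ∧ any (λ v → indeg G v ≡ᵇ 0) C

isFreeLinear : Digraph → List Vertex → Bool
isFreeLinear G C = isLinear G C ∧ all (λ v → not (v ∈ᵇ marked G)) C

c : Digraph → ℕ
c G = count (λ v → isCircular G (component G v)) (representatives G)

ℓ : Digraph → ℕ
ℓ G = count (λ v → isFreeLinear G (component G v)) (representatives G)

removeZeros : List ℤ → List ℤ
removeZeros = filterᵇ nonzero

{-# OPTIONS --safe #-}
module Submission where

-- A zero entry inserted after column q adds a column p whose vertex x_{j,p} stands for the index j
-- of the rule linking column q to its successor: the edge x_{j-A,q} → x_{j-B,q+1} of the shorter
-- sequence becomes x_{j-A,q} → x_{j,p} → x_{j-B,q+1}, and if j < A or j < B then x_{j,p} is marked
-- zero. So outside the components containing a marked vertex, inserting a zero subdivides edges,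
-- and this preserves the numbers of directed cycles and of free paths. For a single nonzero entry
-- the special rule for s = 1 and the general rule both give no cycle and no free path: under the
-- general rule the height is strictly monotone along a path, whose lowest vertex is marked.

open import Defs
open import Data.Bool using (Bool; true; false; T; if_then_else_; not; _∧_)
open import Data.Bool.ListAction using (any; all)
open import Data.Bool.Properties using (T-∧; T?)
open import Data.Empty using (⊥; ⊥-elim)
open import Data.Integer using (ℤ; +_; -[1+_])
open import Data.List
  using (List; []; _∷_; _++_; _∷ʳ_; length; foldr; concatMap; map; filterᵇ; upTo)
open import Data.List.Membership.Propositional using (_∈_; find; lose)
open import Data.List.Membership.Propositional.Properties
  using (∈-concatMap⁺; ∈-concatMap⁻; ∈-++⁻; ∈-++⁺ˡ; ∈-++⁺ʳ; ∈-filter⁺; ∈-filter⁻; ∈-map⁺; ∈-map⁻;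
    ∈-upTo⁺; ∈-upTo⁻)
open import Data.List.Properties
  using (length-removeAt′; filter-none; ∷ʳ-++; length-++; length-++-sucʳ)
open import Data.List.Relation.Binary.Subset.Propositional using (_⊆_)
open import Data.List.Relation.Unary.All as All using (All; []; _∷_)
import Data.List.Relation.Unary.All.Properties as All
open import Data.List.Relation.Unary.AllPairs as AllPairs using (AllPairs; []; _∷_)
import Data.List.Relation.Unary.AllPairs.Properties as AllPairs
open import Data.List.Relation.Unary.Any as Any using (Any; here; there; _─_)
import Data.List.Relation.Unary.Any.Properties as Any
open import Data.List.Relation.Unary.Unique.Propositional using (Unique)
open import Data.Nat
  using (ℕ; zero; suc; _+_; _∸_; _≤_; _<_; _≥_; z≤n; s≤s; s<s; _%_; _≡ᵇ_; _≤ᵇ_; _<ᵇ_)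
open import Data.Nat.DivMod using (m<n⇒m%n≡m; m%n<n; n%n≡0)
open import Data.Nat.Properties
open import Data.Product using (∃; _×_; _,_; proj₁; proj₂)
open import Data.Product.Properties using (,-injectiveˡ)
open import Data.Sum using (_⊎_; inj₁; inj₂)
open import Data.Unit using (tt)
open import Function using (_∋_; _∘_; id; _on_)
open import Function.Bundles using (_⇔_; mk⇔; Equivalence)
open import Level using (0ℓ)
open import Relation.Binary.Construct.Closure.Equivalence using (EqClosure; symmetric)
open import Relation.Binary.Construct.Closure.ReflexiveTransitive using (ε; _◅_; _◅◅_)
open import Relation.Binary.Construct.Closure.Symmetric using (SymClosure; fwd; bwd)
open import Relation.Binary.Core using (Rel)
open import Relation.Binary.Definitions using (tri<; tri≈; tri>)
open import Relation.Binary.PropositionalEquality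
  using (_≡_; _≢_; refl; sym; trans; cong; cong₂; subst; subst₂)
open import Relation.Nullary using (¬_; yes; no; contradiction)

open Equivalence using (to; from)

-- Components of a digraph

-- The inserted column also holds vertices that subdivide nothing: `(j , p)` with `j < up′ q` has no
-- arc entering it, and for `j ≥ down′ q` it adds an arc into a vertex of the next column that had
-- none before. So an arbitrary component is not simply replaced by a subdivision of itself. In both
-- places where this happens a vertex is marked and lacks an entering arc. Hence the transfer of
-- paths carries the disjunction `HasIn ⊎ ¬ Zeroed`: a cycle supplies the first alternative, a free
-- path the second, and one argument serves both counts. `c` and `ℓ` are computed from a list of
-- representatives that depends on the order of the vertices. No bijection between the two lists is
-- built; relations injective on components, one in each direction, give two inequalities. Removing
-- the zeros one by one may end at length one, where `Γ` changes its rule. The induction therefore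
-- runs on `wheel`, and `Γ` is compared with `wheel` separately.

eqV-sound : ∀ u v → T (eqV u v) → u ≡ v
eqV-sound (a , b) (c , d) h with to T-∧ h
... | a≡c , b≡d = cong₂ _,_ (≡ᵇ⇒≡ a c a≡c) (≡ᵇ⇒≡ b d b≡d)

eqV-refl : ∀ v → T (eqV v v)
eqV-refl (a , b) = from T-∧ (≡⇒≡ᵇ a a refl , ≡⇒≡ᵇ b b refl)

∈ᵇ⇒∈ : ∀ {v S} → T (v ∈ᵇ S) → v ∈ S
∈ᵇ⇒∈ {v} {S} h = Any.map (eqV-sound v _) (Any.any⁻ (eqV v) S h)

∈⇒∈ᵇ : ∀ {v S} → v ∈ S → T (v ∈ᵇ S)
∈⇒∈ᵇ {v} v∈S = Any.any⁺ (eqV v) (Any.map (λ { refl → eqV-refl v }) v∈S)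

¬T⇒T-not : ∀ {b} → ¬ T b → T (not b)
¬T⇒T-not {true}  ¬b = ⊥-elim (¬b tt)
¬T⇒T-not {false} _  = tt

T-not⇒¬T : ∀ {b} → T (not b) → ¬ T b
T-not⇒¬T {false} _ ()

module _ {A B : Set} {R : A → B → Set} where

  private
    Any-─ : ∀ {x y ys} → (∀ {z} → R x z → ¬ R y z) →
            (p : Any (R x) ys) → Any (R y) ys → Any (R y) (ys ─ p)
    Any-─ apart (here r)  (here r′)  = ⊥-elim (apart r r′)
    Any-─ apart (here r)  (there p′) = p′
    Any-─ apart (there p) (here r′)  = here r′
    Any-─ apart (there p) (there p′) = there (Any-─ apart p p′)

  -- Deleting the witness of the head from `ys` leaves a witness for every other entry, because no
  -- `z` serves two entries. With `R` a relation, "lies in a component matching `x`" can be used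
  -- directly, without choosing a map.
  pigeonhole : ∀ {xs ys} → AllPairs (λ x y → ∀ {z} → R x z → ¬ R y z) xs →
               All (λ x → Any (R x) ys) xs → length xs ≤ length ys
  pigeonhole []             []        = z≤n
  pigeonhole {ys = ys} (apart ∷ aparts) (p ∷ ps) =
    subst (_ ≤_) (sym (length-removeAt′ ys (Any.index p)))
      (s≤s (pigeonhole aparts (All.tabulate (λ y∈ →
        Any-─ (λ {z} → All.lookup apart y∈ {z}) p (All.lookup ps y∈)))))

Unique-⊆⇒length≤ : ∀ {A : Set} {xs ys : List A} → Unique xs → xs ⊆ ys → length xs ≤ length ys
Unique-⊆⇒length≤ xs! xs⊆ys =
  pigeonhole {R = _≡_} (AllPairs.map (λ { x≢y refl y≡x → x≢y (sym y≡x) }) xs!) (All.tabulate xs⊆ys)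

module _ {A : Set} (p : A → Bool) where

  count-≤1 : ∀ {xs} → AllPairs (λ x y → T (p x) → ¬ T (p y)) xs → count p xs ≤ 1
  count-≤1 []              = z≤n
  count-≤1 {x ∷ xs} (apart ∷ aparts) with p x
  ... | false = count-≤1 aparts
  ... | true  rewrite filter-none (T? ∘ p) (All.map (λ ¬py → ¬py tt) apart) = s≤s z≤n

  count-pos⁺ : ∀ {x xs} → x ∈ xs → T (p x) → 1 ≤ count p xs
  count-pos⁺ {xs = xs} x∈xs px with filterᵇ p xs | ∈-filter⁺ (T? ∘ p) x∈xs px
  ... | _ ∷ _ | _ = s≤s z≤n

  count-pos⁻ : ∀ {xs} → 1 ≤ count p xs → ∃ λ x → x ∈ xs × T (p x)
  count-pos⁻ {xs} 1≤ with filterᵇ p xs in eq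
  ... | x ∷ _ = x , ∈-filter⁻ (T? ∘ p) (subst (x ∈_) (sym eq) (here refl))

mutual
  -- Names the local function of representatives: abstracting its initial arguments
  -- turns the goal into an equation that determines the metavariable.
  scan : Digraph → List Vertex → List Vertex → List Vertex
  scan = _

  representatives-scan : ∀ G → representatives G ≡ scan G [] (vertices G)
  representatives-scan G with List Vertex ∋ [] | vertices G
  ... | seen | vs = refl

HasOut HasIn : Rel Vertex 0ℓ → Vertex → Set
HasOut E u = ∃ λ v → E u v
HasIn  E u = ∃ λ v → E v u

Circular : Rel Vertex 0ℓ → Vertex → Set
Circular E v = ∀ {u} → EqClosure E v u → HasOut E u × HasIn E u

-- The degree bounds tested by `isLinear` are supplied by `sources!` and `targets!` of `Presents`,
-- so only the marks and the existence of a start depend on the component.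
FreeLinear : Rel Vertex 0ℓ → (Vertex → Set) → Vertex → Set
FreeLinear E M v = (∀ {u} → EqClosure E v u → ¬ M u) × ∃ λ u → EqClosure E v u × ¬ HasIn E u

source target : Edge → Vertex
source (u , _ , _) = u
target (_ , v , _) = v

-- Weights are forgotten. The last two fields speak of positions in the edge list, since `outdeg`
-- and `indeg` count edges with multiplicity; they bound every degree by one.
record Presents (G : Digraph) (E : Rel Vertex 0ℓ) (M : Vertex → Set) : Set where
  field
    edge⁺    : ∀ {u v} → E u v → ∃ λ w → (u , v , w) ∈ edges G
    edge⁻    : ∀ {u v w} → (u , v , w) ∈ edges G → E u v
    marked⁺  : ∀ {v} → M v → v ∈ marked G
    marked⁻  : ∀ {v} → v ∈ marked G → M v
    source∈  : ∀ {u v} → E u v → u ∈ vertices G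
    target∈  : ∀ {u v} → E u v → v ∈ vertices G
    sources! : AllPairs (_≢_ on source) (edges G)
    targets! : AllPairs (_≢_ on target) (edges G)

-- Computing a component by closure under neighbours

insert : Vertex → List Vertex → List Vertex
insert u acc = if u ∈ᵇ acc then acc else u ∷ acc

∈-insert⁻ : ∀ {v} u S → v ∈ insert u S → v ≡ u ⊎ v ∈ S
∈-insert⁻ u S v∈ with u ∈ᵇ S
... | true = inj₂ v∈
∈-insert⁻ u S (here v≡u) | false = inj₁ v≡u
∈-insert⁻ u S (there v∈) | false = inj₂ v∈

∈-inserts⁻ : ∀ {v} us S → v ∈ foldr insert S us → v ∈ us ⊎ v ∈ S
∈-inserts⁻ []       S v∈ = inj₂ v∈
∈-inserts⁻ (u ∷ us) S v∈ with ∈-insert⁻ u (foldr insert S us) v∈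
... | inj₁ v≡u = inj₁ (here v≡u)
... | inj₂ v∈′ with ∈-inserts⁻ us S v∈′
...   | inj₁ v∈us = inj₁ (there v∈us)
...   | inj₂ v∈S  = inj₂ v∈S

insert-unique : ∀ u {S} → Unique S → Unique (insert u S)
insert-unique u {S} S! with u ∈ᵇ S in eq
... | true  = S!
... | false = All.tabulate (λ { x∈S refl → subst T eq (∈⇒∈ᵇ x∈S) }) ∷ S!

inserts-unique : ∀ us {S} → Unique S → Unique (foldr insert S us)
inserts-unique []       S! = S!
inserts-unique (u ∷ us) S! = insert-unique u (inserts-unique us S!)

⊆-insert : ∀ u S → S ⊆ insert u S
⊆-insert u S v∈ with u ∈ᵇ S
... | true  = v∈
... | false = there v∈

⊆-inserts : ∀ us S → S ⊆ foldr insert S us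
⊆-inserts []       S = id
⊆-inserts (u ∷ us) S = ⊆-insert u (foldr insert S us) ∘ ⊆-inserts us S

inserts-grow : ∀ us S → (foldr insert S us ≡ S × us ⊆ S) ⊎ length S < length (foldr insert S us)
inserts-grow []       S = inj₁ (refl , λ ())
inserts-grow (u ∷ us) S with inserts-grow us S
... | inj₂ S< with u ∈ᵇ foldr insert S us
...   | true  = inj₂ S<
...   | false = inj₂ (m<n⇒m<1+n S<)
inserts-grow (u ∷ us) S | inj₁ (≡S , us⊆S) rewrite ≡S with u ∈ᵇ S in eq
... | true  = inj₁ (refl , λ { (here refl) → ∈ᵇ⇒∈ (subst T (sym eq) tt) ; (there v∈) → us⊆S v∈ })
... | false = inj₂ (n<1+n _)

module _ {A : Set} {x y : A} where

  ∈-if⁻ : ∀ b → x ∈ (if b then y ∷ [] else []) → T b × x ≡ y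
  ∈-if⁻ true (here x≡y) = tt , x≡y

  ∈-if⁺ : ∀ {b} → T b → x ≡ y → x ∈ (if b then y ∷ [] else [])
  ∈-if⁺ {true} _ x≡y = here x≡y

module _ {G : Digraph} {E : Rel Vertex 0ℓ} {M : Vertex → Set} (G-presents : Presents G E M) where
  open Presents G-presents

  private
    infix 4 _~_
    _~_ : Rel Vertex 0ℓ
    _~_ = EqClosure E

    ~-sym : ∀ {u v} → u ~ v → v ~ u
    ~-sym = symmetric E

  neighbours⁻ : ∀ {u v} → u ∈ neighbours G v → SymClosure E v u
  neighbours⁻ {u} {v} u∈ with find (∈-concatMap⁻ _ {xs = edges G} u∈)
  ... | (a , b , w) , e∈ , u∈e with ∈-++⁻ (if eqV a v then b ∷ [] else []) u∈e
  ...   | inj₁ h with a≡v , refl ← ∈-if⁻ (eqV a v) h with refl ← eqV-sound a v a≡v = fwd (edge⁻ e∈)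
  ...   | inj₂ h with b≡v , refl ← ∈-if⁻ (eqV b v) h with refl ← eqV-sound b v b≡v = bwd (edge⁻ e∈)

  neighbours⁺ : ∀ {u v} → SymClosure E v u → u ∈ neighbours G v
  neighbours⁺ {u} {v} (fwd e) =
    ∈-concatMap⁺ _ (lose (proj₂ (edge⁺ e)) (∈-++⁺ˡ (∈-if⁺ (eqV-refl v) refl)))
  neighbours⁺ {u} {v} (bwd e) =
    ∈-concatMap⁺ _ (lose (proj₂ (edge⁺ e)) (∈-++⁺ʳ (if eqV u v then v ∷ [] else []) (∈-if⁺ (eqV-refl v) refl)))

  neighbour∈ : ∀ {u v} → SymClosure E v u → u ∈ vertices G
  neighbour∈ (fwd e) = target∈ e
  neighbour∈ (bwd e) = source∈ e

  ~-vertex : ∀ {u v} → v ∈ vertices G → v ~ u → u ∈ vertices G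
  ~-vertex v∈ ε         = v∈
  ~-vertex v∈ (e ◅ w~u) = ~-vertex (neighbour∈ e) w~u

  Closed : List Vertex → Set
  Closed S = ∀ {u w} → u ∈ S → SymClosure E u w → w ∈ S

  ∈-step⁻ : ∀ {S w} → w ∈ step G S → (∃ λ u → u ∈ S × SymClosure E u w) ⊎ w ∈ S
  ∈-step⁻ {S} w∈ with ∈-inserts⁻ (concatMap (neighbours G) S) S w∈
  ... | inj₂ w∈S = inj₂ w∈S
  ... | inj₁ w∈N with u , u∈S , w∈ ← find (∈-concatMap⁻ (neighbours G) {xs = S} w∈N) =
    inj₁ (u , u∈S , neighbours⁻ w∈)

  step-grows : ∀ S → (step G S ≡ S × Closed S) ⊎ length S < length (step G S)
  step-grows S with inserts-grow (concatMap (neighbours G) S) S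
  ... | inj₂ S<         = inj₂ S<
  ... | inj₁ (≡S , N⊆S) =
    inj₁ (≡S , λ u∈S e → N⊆S (∈-concatMap⁺ (neighbours G) (lose u∈S (neighbours⁺ e))))

  iter-fixed : ∀ n {S} → step G S ≡ S → iter n (step G) S ≡ S
  iter-fixed zero    ≡S = refl
  iter-fixed (suc n) ≡S rewrite ≡S = iter-fixed n ≡S

  -- A step either lengthens the list or returns it literally unchanged and closed; in the second
  -- case all later steps return it too.
  iter-grows : ∀ n S → Closed (iter n (step G) S) ⊎ n + length S ≤ length (iter n (step G) S)
  iter-grows zero    S = inj₂ ≤-refl
  iter-grows (suc n) S with step-grows S
  ... | inj₁ (≡S , closed) rewrite ≡S | iter-fixed n ≡S = inj₁ closed
  ... | inj₂ S< with iter-grows n (step G S)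
  ...   | inj₁ closed = inj₁ closed
  ...   | inj₂ n+S≤   =
    inj₂ (≤-trans (≤-trans (≤-reflexive (sym (+-suc n (length S)))) (+-monoʳ-≤ n S<)) n+S≤)

  iter-unique : ∀ n {S} → Unique S → Unique (iter n (step G) S)
  iter-unique zero    S! = S!
  iter-unique (suc n) {S} S! = iter-unique n (inserts-unique (concatMap (neighbours G) S) S!)

  iter-extends : ∀ n {S} → S ⊆ iter n (step G) S
  iter-extends zero    = id
  iter-extends (suc n) {S} = iter-extends n ∘ ⊆-inserts (concatMap (neighbours G) S) S

  iter-sound : ∀ n {S v} → (∀ {u} → u ∈ S → v ~ u) → ∀ {u} → u ∈ iter n (step G) S → v ~ u
  iter-sound zero    v~S = v~S
  iter-sound (suc n) {S} {v} v~S = iter-sound n v~step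
    where
    v~step : ∀ {u} → u ∈ step G S → v ~ u
    v~step u∈ with ∈-step⁻ u∈
    ... | inj₂ u∈S             = v~S u∈S
    ... | inj₁ (w , w∈S , w-u) = v~S w∈S ◅◅ (w-u ◅ ε)

  component⁻ : ∀ {v u} → u ∈ component G v → v ~ u
  component⁻ = iter-sound (length (vertices G)) (λ { (here refl) → ε })

  -- Otherwise as many lengthenings of the singleton as `vertices G` has entries would produce a
  -- duplicate-free list of vertices with one entry more than `vertices G`.
  component-closed : ∀ {v} → v ∈ vertices G → Closed (component G v)
  component-closed {v} v∈ with iter-grows (length (vertices G)) (v ∷ [])
  ... | inj₁ closed = closed
  ... | inj₂ too-long = contradiction
    (≤-trans (≤-reflexive (+-comm 1 _))
      (≤-trans too-long
        (Unique-⊆⇒length≤ (iter-unique (length (vertices G)) ([] ∷ [])) (λ u∈ → ~-vertex v∈ (component⁻ u∈)))))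
    1+n≰n

  component⁺ : ∀ {v u} → v ∈ vertices G → v ~ u → u ∈ component G v
  component⁺ {v} v∈ = close (iter-extends (length (vertices G)) (here refl))
    where
    close : ∀ {w u} → w ∈ component G v → w ~ u → u ∈ component G v
    close w∈ ε         = w∈
    close w∈ (e ◅ x~u) = close (component-closed v∈ w∈ e) x~u

  scan-⊆ : ∀ seen vs → scan G seen vs ⊆ vs
  scan-⊆ seen (v ∷ vs) u∈ with any (_∈ᵇ component G v) seen
  scan-⊆ seen (v ∷ vs) u∈         | true  = there (scan-⊆ (v ∷ seen) vs u∈)
  scan-⊆ seen (v ∷ vs) (here u≡v) | false = here u≡v
  scan-⊆ seen (v ∷ vs) (there u∈) | false = there (scan-⊆ (v ∷ seen) vs u∈)

  scan-fresh : ∀ seen vs → vs ⊆ vertices G → ∀ {u s} → u ∈ scan G seen vs → s ∈ seen → ¬ s ~ u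
  scan-fresh seen (v ∷ vs) vs⊆ u∈ s∈ s~u with any (_∈ᵇ component G v) seen in eq
  scan-fresh seen (v ∷ vs) vs⊆ u∈ s∈ s~u          | true  =
    scan-fresh (v ∷ seen) vs (vs⊆ ∘ there) u∈ (there s∈) s~u
  scan-fresh seen (v ∷ vs) vs⊆ (there u∈) s∈ s~u  | false =
    scan-fresh (v ∷ seen) vs (vs⊆ ∘ there) u∈ (there s∈) s~u
  scan-fresh seen (v ∷ vs) vs⊆ (here refl) s∈ s~u | false =
    subst T eq (Any.any⁺ _ (lose s∈ (∈⇒∈ᵇ (component⁺ (vs⊆ (here refl)) (~-sym s~u)))))

  scan-separated : ∀ seen vs → vs ⊆ vertices G → AllPairs (λ u v → ¬ u ~ v) (scan G seen vs)
  scan-separated seen []       vs⊆ = []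
  scan-separated seen (v ∷ vs) vs⊆ with any (_∈ᵇ component G v) seen
  ... | true  = scan-separated (v ∷ seen) vs (vs⊆ ∘ there)
  ... | false = All.tabulate (λ u∈ → scan-fresh (v ∷ seen) vs (vs⊆ ∘ there) u∈ (here refl))
                ∷ scan-separated (v ∷ seen) vs (vs⊆ ∘ there)

  -- The first alternative makes the induction work: a vertex that is passed over is joined to an
  -- earlier one in `seen`, so being joined to it reduces to being joined to that one. With `seen`
  -- empty only a representative can remain.
  scan-covers : ∀ seen vs {v} → v ∈ vs → Any (v ~_) seen ⊎ Any (v ~_) (scan G seen vs)
  scan-covers seen (x ∷ vs) v∈ with any (_∈ᵇ component G x) seen in eq
  scan-covers seen (x ∷ vs) (here refl) | false = inj₂ (here ε)
  scan-covers seen (x ∷ vs) (here refl) | true  =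
    inj₁ (Any.map (component⁻ ∘ ∈ᵇ⇒∈) (Any.any⁻ (_∈ᵇ component G x) seen (subst T (sym eq) tt)))
  scan-covers seen (x ∷ vs) (there v∈)  | b with scan-covers (x ∷ seen) vs v∈
  scan-covers seen (x ∷ vs) (there v∈)  | b     | inj₁ (there v~s) = inj₁ v~s
  scan-covers seen (x ∷ vs) (there v∈)  | false | inj₁ (here v~x)  = inj₂ (here v~x)
  scan-covers seen (x ∷ vs) (there v∈)  | false | inj₂ v~r         = inj₂ (there v~r)
  scan-covers seen (x ∷ vs) (there v∈)  | true  | inj₂ v~r         = inj₂ v~r
  scan-covers seen (x ∷ vs) (there v∈)  | true  | inj₁ (here v~x)  =
    inj₁ (Any.map (λ s∈ → v~x ◅◅ component⁻ (∈ᵇ⇒∈ s∈))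
      (Any.any⁻ (_∈ᵇ component G x) seen (subst T (sym eq) tt)))

  representatives-⊆ : representatives G ⊆ vertices G
  representatives-⊆ rewrite representatives-scan G = scan-⊆ [] (vertices G)

  representatives-separated : AllPairs (λ u v → ¬ u ~ v) (representatives G)
  representatives-separated rewrite representatives-scan G = scan-separated [] (vertices G) id

  representatives-cover : ∀ {v} → v ∈ vertices G → Any (v ~_) (representatives G)
  representatives-cover v∈ rewrite representatives-scan G with scan-covers [] (vertices G) v∈
  ... | inj₂ v~r = v~r

  outdeg≤1 : ∀ v → outdeg G v ≤ 1
  outdeg≤1 v = count-≤1 _ (AllPairs.map
    (λ u≢u′ u≡v u′≡v → u≢u′ (trans (eqV-sound _ v u≡v) (sym (eqV-sound _ v u′≡v)))) sources!)

  indeg≤1 : ∀ v → indeg G v ≤ 1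
  indeg≤1 v = count-≤1 _ (AllPairs.map
    (λ u≢u′ u≡v u′≡v → u≢u′ (trans (eqV-sound _ v u≡v) (sym (eqV-sound _ v u′≡v)))) targets!)

  HasOut⇒outdeg : ∀ {v} → HasOut E v → 1 ≤ outdeg G v
  HasOut⇒outdeg {v} (_ , e) = count-pos⁺ _ (proj₂ (edge⁺ e)) (eqV-refl v)

  HasIn⇒indeg : ∀ {v} → HasIn E v → 1 ≤ indeg G v
  HasIn⇒indeg {v} (_ , e) = count-pos⁺ _ (proj₂ (edge⁺ e)) (eqV-refl v)

  outdeg⇒HasOut : ∀ {v} → 1 ≤ outdeg G v → HasOut E v
  outdeg⇒HasOut {v} h with (u , u′ , _) , e∈ , u≡v ← count-pos⁻ _ {xs = edges G} h
    with refl ← eqV-sound u v u≡v = u′ , edge⁻ e∈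

  indeg⇒HasIn : ∀ {v} → 1 ≤ indeg G v → HasIn E v
  indeg⇒HasIn {v} h with (u , u′ , _) , e∈ , u′≡v ← count-pos⁻ _ {xs = edges G} h
    with refl ← eqV-sound u′ v u′≡v = u , edge⁻ e∈

  isCircular⇔ : ∀ {v} → v ∈ vertices G → T (isCircular G (component G v)) ⇔ Circular E v
  isCircular⇔ {v} v∈ = mk⇔ sound complete
    where
    deg1 : Vertex → Bool
    deg1 u = (outdeg G u ≡ᵇ 1) ∧ (indeg G u ≡ᵇ 1)

    sound : T (all deg1 (component G v)) → Circular E v
    sound h {u} v~u with to T-∧ (All.lookup (All.all⁺ deg1 _ h) (component⁺ v∈ v~u))
    ... | out , inn = outdeg⇒HasOut (≤-reflexive (sym (≡ᵇ⇒≡ (outdeg G u) 1 out)))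
                    , indeg⇒HasIn (≤-reflexive (sym (≡ᵇ⇒≡ (indeg G u) 1 inn)))

    complete : Circular E v → T (all deg1 (component G v))
    complete circ = All.all⁻ deg1 (All.tabulate (λ {u} u∈ → let out , inn = circ (component⁻ u∈) in
      from T-∧ ( ≡⇒≡ᵇ (outdeg G u) 1 (≤-antisym (outdeg≤1 u) (HasOut⇒outdeg out))
               , ≡⇒≡ᵇ (indeg G u) 1 (≤-antisym (indeg≤1 u) (HasIn⇒indeg inn)))))

  isFreeLinear⇔ : ∀ {v} → v ∈ vertices G → T (isFreeLinear G (component G v)) ⇔ FreeLinear E M v
  isFreeLinear⇔ {v} v∈ = mk⇔ sound complete
    where
    deg≤1 start unmarked : Vertex → Bool
    deg≤1 u    = (outdeg G u ≤ᵇ 1) ∧ (indeg G u ≤ᵇ 1)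
    start u    = indeg G u ≡ᵇ 0
    unmarked u = not (u ∈ᵇ marked G)

    sound : T ((all deg≤1 (component G v) ∧ any start (component G v)) ∧ all unmarked (component G v)) →
            FreeLinear E M v
    sound h with to T-∧ h
    ... | linear , free with find (Any.any⁻ start _ (proj₂ (to (T-∧ {all deg≤1 (component G v)}) linear)))
    ...   | u , u∈ , start-u =
      (λ v~w marked-w → T-not⇒¬T (All.lookup (All.all⁺ unmarked _ free) (component⁺ v∈ v~w))
          (∈⇒∈ᵇ (marked⁺ marked-w)))
      , u , component⁻ u∈ , λ inn → contradiction (≡ᵇ⇒≡ (indeg G u) 0 start-u) (m<n⇒n≢0 (HasIn⇒indeg inn))

    complete : FreeLinear E M v →
               T ((all deg≤1 (component G v) ∧ any start (component G v)) ∧ all unmarked (component G v))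
    complete (free , u , v~u , ¬in) = from T-∧
      ( from T-∧
          ( All.all⁻ deg≤1 {component G v} (All.tabulate (λ {w} _ →
              from T-∧ (≤⇒≤ᵇ (outdeg≤1 w) , ≤⇒≤ᵇ (indeg≤1 w))))
          , Any.any⁺ start (lose (component⁺ v∈ v~u)
              (≡⇒≡ᵇ (indeg G u) 0 (n<1⇒n≡0 (≰⇒> (¬in ∘ indeg⇒HasIn))))))
      , All.all⁻ unmarked (All.tabulate (λ w∈ →
          ¬T⇒T-not (λ w∈M → free (component⁻ w∈) (marked⁻ (∈ᵇ⇒∈ w∈M))))))

Circular-resp : ∀ {E u v} → EqClosure E u v → Circular E u → Circular E v
Circular-resp u~v circ v~w = circ (u~v ◅◅ v~w)

FreeLinear-resp : ∀ {E M u v} → EqClosure E u v → FreeLinear E M u → FreeLinear E M v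
FreeLinear-resp {E} u~v (free , w , u~w , ¬in) =
  (λ v~x → free (u~v ◅◅ v~x)) , w , symmetric E u~v ◅◅ u~w , ¬in

module _ {G H : Digraph} {E F : Rel Vertex 0ℓ} {M N : Vertex → Set}
         (G-presents : Presents G E M) (H-presents : Presents H F N) where

  -- Choosing R-images injects the components of G satisfying P into those of H satisfying Q.
  representatives-count-≤ :
    (p q : Vertex → Bool) (P Q : Vertex → Set) (R : Rel Vertex 0ℓ) →
    (∀ {v} → v ∈ vertices G → T (p v) → P v) →
    (∀ {v} → v ∈ vertices H → Q v → T (q v)) →
    (∀ {u v} → EqClosure F u v → Q u → Q v) →
    (∀ {v} → v ∈ vertices G → P v → ∃ λ v′ → v′ ∈ vertices H × R v v′ × Q v′) →
    (∀ {u v u′ v′} → P v → R u u′ → R v v′ → EqClosure F u′ v′ → EqClosure E u v) →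
    count p (representatives G) ≤ count q (representatives H)
  representatives-count-≤ p q P Q R p⇒P Q⇒q Q-resp R-total R-reflects =
    pigeonhole {R = Joins}
      (AllPairs.filter⁺ (T? ∘ p) (AllPairs.map
        (λ { u≁v (_ , _ , Ruu′ , u′~z) (Pv , _ , Rvv′ , v′~z) →
             u≁v (R-reflects Pv Ruu′ Rvv′ (u′~z ◅◅ symmetric F v′~z)) })
        (representatives-separated G-presents)))
      (All.tabulate joined)
    where
    Joins : Vertex → Vertex → Set
    Joins v z = P v × ∃ λ v′ → R v v′ × EqClosure F v′ z

    joined : ∀ {v} → v ∈ filterᵇ p (representatives G) → Any (Joins v) (filterᵇ q (representatives H))
    joined v∈
      with v∈reps , pv ← ∈-filter⁻ (T? ∘ p) {xs = representatives G} v∈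
      with Pv ← p⇒P (representatives-⊆ G-presents v∈reps) pv
      with v′ , v′∈ , Rvv′ , Qv′ ← R-total (representatives-⊆ G-presents v∈reps) Pv
      with z , z∈ , v′~z ← find (representatives-cover H-presents v′∈) =
      lose (∈-filter⁺ (T? ∘ q) z∈ (Q⇒q (representatives-⊆ H-presents z∈) (Q-resp v′~z Qv′)))
           (Pv , v′ , Rvv′ , v′~z)

module _ {G : Digraph} {E : Rel Vertex 0ℓ} {M : Vertex → Set} (G-presents : Presents G E M) where

  representatives-count-0 : (p : Vertex → Bool) → (∀ {v} → v ∈ vertices G → ¬ T (p v)) →
                            count p (representatives G) ≡ 0
  representatives-count-0 p ¬p =
    cong length (filter-none (T? ∘ p) (All.tabulate (¬p ∘ representatives-⊆ G-presents)))

-- Inserting a zero column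

-- up t = max(ε_t, 0) and down t = max(-ε_{t+1}, 0) are the paper's A_t and B_t.
record Columns : Set where
  field
    size         : ℕ
    next up down : ℕ → ℕ

-- The paper's j is up t + i = down t + k.
Arc : ℕ → Columns → Rel Vertex 0ℓ
Arc m C (i , t) (k , t′) = t < size × t′ ≡ next t × up t + i ≡ down t + k × up t + i < m
  where open Columns C

-- Here `up t + i`, respectively `down t + k`, is the index of a rule that yields no arc: `tail`
-- marks the vertex whose arc would end at a negative height, `head` the vertex whose arc would
-- start at one.
data Zeroed (m : ℕ) (C : Columns) : Vertex → Set where
  tail : let open Columns C in ∀ {i t} →
         t < size → up t + i < m → up t + i < down t → Zeroed m C (i , t)
  head : let open Columns C in ∀ {k t t′} →
         t < size → t′ ≡ next t → down t + k < m → down t + k < up t → Zeroed m C (k , t′)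

-- C arises from C′ by inserting a column p with zero entry right after column q of C′,
-- the other columns being renumbered by σ.
record Insertion (C C′ : Columns) : Set where
  open Columns C
  open Columns C′ renaming (size to size′; next to next′; up to up′; down to down′)
  field
    σ              : ℕ → ℕ
    p q            : ℕ
    σ-injective    : ∀ {t u} → σ t ≡ σ u → t ≡ u
    σ≢p            : ∀ {t} → σ t ≢ p
    σ-size         : ∀ {t} → t < size′ → σ t < size
    p-size         : p < size
    q-size         : q < size′
    σ-or-p         : ∀ {t} → t < size → t ≡ p ⊎ ∃ λ t′ → t ≡ σ t′ × t′ < size′
    next′-size     : ∀ {t} → t < size′ → next′ t < size′
    next′-injective : ∀ {t u} → t < size′ → u < size′ → next′ t ≡ next′ u → t ≡ u
    next-σ         : ∀ {t} → t < size′ → t ≢ q → next (σ t) ≡ σ (next′ t)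
    next-σq        : next (σ q) ≡ p
    next-p         : next p ≡ σ (next′ q)
    up-σ           : ∀ {t} → t < size′ → up (σ t) ≡ up′ t
    up-p           : up p ≡ 0
    down-σ         : ∀ {t} → t < size′ → t ≢ q → down (σ t) ≡ down′ t
    down-σq        : down (σ q) ≡ 0
    down-p         : down p ≡ down′ q

module _ (m : ℕ) {C C′ : Columns} (ins : Insertion C C′) where
  open Columns C
  open Columns C′ renaming (size to size′; next to next′; up to up′; down to down′)
  open Insertion ins

  private
    E E′ : Rel Vertex 0ℓ
    E  = Arc m C
    E′ = Arc m C′

    Z Z′ : Vertex → Set
    Z  = Zeroed m C
    Z′ = Zeroed m C′

    infix 4 _~_ _~′_
    _~_ _~′_ : Rel Vertex 0ℓ
    _~_  = EqClosure E
    _~′_ = EqClosure E′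

    F : Vertex → Vertex
    F (i , t) = i , σ t

  -- Every arc of C′ out of column q is subdivided by the vertex of column p at its height j;
  -- that vertex is identified with the tail of the subdivided arc.
  data _▷_ : Rel Vertex 0ℓ where
    kept    : ∀ {i s t} → s ≡ σ t → t < size′ → (i , s) ▷ (i , t)
    crossed : ∀ {i j s t} → s ≡ p → t ≡ q → j ≡ up′ q + i → j < m → (j , s) ▷ (i , t)

  -- The columns enter through equations such as `s ≡ σ t` because `σ` is an abstract function that
  -- unification cannot invert; two descriptions of one vertex are then compared by `σ-injective`
  -- and `σ≢p`. Heights are expressed through `up′` and `down′`, as both halves of a subdivided arc
  -- refer to the single rule at `q`.
  data ArcView : Rel Vertex 0ℓ where
    plain : ∀ {i k s r t w} → s ≡ σ t → r ≡ σ w → t ≢ q → E′ (i , t) (k , w) → ArcView (i , s) (k , r)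
    enter : ∀ {i j s r} → s ≡ σ q → r ≡ p → j ≡ up′ q + i → j < m → ArcView (i , s) (j , r)
    leave : ∀ {j k s r} → s ≡ p → r ≡ σ (next′ q) → j ≡ down′ q + k → j < m → ArcView (j , s) (k , r)

  view : ∀ {u v} → E u v → ArcView u v
  view (s< , refl , eq , <m) with σ-or-p s<
  ... | inj₁ refl rewrite up-p | down-p = leave refl next-p eq <m
  ... | inj₂ (t , refl , t<) with t ≟ q
  ...   | yes refl rewrite up-σ t< | down-σq = enter refl next-σq (sym eq) (subst (_< m) eq <m)
  ...   | no  t≢q  rewrite up-σ t< | down-σ t< t≢q = plain refl (next-σ t< t≢q) t≢q (t< , refl , eq , <m)

  unview : ∀ {u v} → ArcView u v → E u v
  unview (plain refl refl t≢q (t< , refl , eq , <m)) =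
    σ-size t< , sym (next-σ t< t≢q)
    , trans (cong (_+ _) (up-σ t<)) (trans eq (cong (_+ _) (sym (down-σ t< t≢q))))
    , subst (λ a → a + _ < m) (sym (up-σ t<)) <m
  unview (enter refl refl refl <m) =
    σ-size q-size , sym next-σq
    , trans (cong (_+ _) (up-σ q-size)) (cong (_+ (up′ q + _)) (sym down-σq))
    , subst (λ a → a + _ < m) (sym (up-σ q-size)) <m
  unview (leave refl refl refl <m) =
    p-size , sym next-p
    , trans (cong (_+ (down′ q + _)) up-p) (cong (_+ _) (sym down-p))
    , subst (λ a → a + _ < m) (sym up-p) <m

  data ZeroedView : Vertex → Set where
    plain : ∀ {i s t} → s ≡ σ t → Z′ (i , t) → ZeroedView (i , s)
    gap   : ∀ {i s} → s ≡ p → i < m → i < up′ q ⊎ i < down′ q → ZeroedView (i , s)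

  zeroedView : ∀ {v} → Z v → ZeroedView v
  zeroedView (tail s< <m <down) with σ-or-p s<
  ... | inj₁ refl rewrite up-p | down-p = gap refl <m (inj₂ <down)
  ... | inj₂ (t , refl , t<) with t ≟ q
  ...   | yes refl = contradiction (subst (_ <_) down-σq <down) n≮0
  ...   | no  t≢q  rewrite up-σ t< | down-σ t< t≢q = plain refl (tail t< <m <down)
  zeroedView (head s< refl <m <up) with σ-or-p s<
  ... | inj₁ refl = contradiction (subst (_ <_) up-p <up) n≮0
  ... | inj₂ (t , refl , t<) with t ≟ q
  ...   | yes refl rewrite up-σ t< | down-σq = gap next-σq <m (inj₁ <up)
  ...   | no  t≢q  rewrite up-σ t< | down-σ t< t≢q = plain (next-σ t< t≢q) (head t< refl <m <up)

  gap-zeroed : ∀ {i} → i < m → i < up′ q ⊎ i < down′ q → Z (i , p)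
  gap-zeroed {i} i<m (inj₁ i<up) = head (σ-size q-size) (sym next-σq)
    (subst (λ b → b + i < m) (sym down-σq) i<m)
    (subst₂ (λ b a → b + i < a) (sym down-σq) (sym (up-σ q-size)) i<up)
  gap-zeroed {i} i<m (inj₂ i<down) = tail p-size
    (subst (λ a → a + i < m) (sym up-p) i<m)
    (subst₂ (λ a b → a + i < b) (sym up-p) (sym down-p) i<down)

  F-arc : ∀ {u′ v′} → E′ u′ v′ → F u′ ~ F v′
  F-arc {i , t} {k , w} e@(t< , refl , eq , <m) with t ≟ q
  ... | no  t≢q  = fwd (unview (plain refl refl t≢q e)) ◅ ε
  ... | yes refl = fwd (unview (enter refl refl refl <m)) ◅ fwd (unview (leave refl refl eq <m)) ◅ ε

  F-~ : ∀ {u′ v′} → u′ ~′ v′ → F u′ ~ F v′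
  F-~ ε           = ε
  F-~ (fwd e ◅ r) = F-arc e ◅◅ F-~ r
  F-~ (bwd e ◅ r) = symmetric E (F-arc e) ◅◅ F-~ r

  ▷-F : ∀ {u u′} → u ▷ u′ → u ~ F u′
  ▷-F (kept refl _)            = ε
  ▷-F (crossed refl refl j≡ j<) = bwd (unview (enter refl refl j≡ j<)) ◅ ε

  -- The only critical move goes backwards along a `leave` arc to `(j , p)`. If `j < up′ q`, that
  -- vertex has no counterpart; but then `u′` is zeroed as a `head` and no arc enters it, so each
  -- alternative of `ok` rules this out. All other moves are matched by one arc of `C′` or by
  -- staying in place.
  ▷-step : ∀ {u u′ w} → HasIn E′ u′ ⊎ ¬ Z′ u′ → u ▷ u′ → SymClosure E u w →
           ∃ λ w′ → w ▷ w′ × u′ ~′ w′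
  ▷-step {u} {u′} {w} ok u▷u′ (fwd e) = go u▷u′ (view e)
    where
    go : ∀ {u u′ w} → u ▷ u′ → ArcView u w → ∃ λ w′ → w ▷ w′ × u′ ~′ w′
    go (kept s≡ _) (plain s≡′ r≡ _ e′@(t< , refl , _)) with refl ← σ-injective (trans (sym s≡) s≡′) =
      _ , kept r≡ (next′-size t<) , fwd e′ ◅ ε
    go (kept s≡ _) (enter s≡′ r≡ j≡ j<) with refl ← σ-injective (trans (sym s≡) s≡′) =
      _ , crossed r≡ refl j≡ j< , ε
    go (kept s≡ _) (leave s≡′ _ _ _) = contradiction (trans (sym s≡) s≡′) σ≢p
    go (crossed s≡ _ _ _) (plain s≡′ _ _ _) = contradiction (trans (sym s≡′) s≡) σ≢p
    go (crossed s≡ _ _ _) (enter s≡′ _ _ _) = contradiction (trans (sym s≡′) s≡) σ≢p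
    go (crossed _ refl refl j<) (leave _ r≡ j≡ _) =
      _ , kept r≡ (next′-size q-size) , fwd (q-size , refl , j≡ , j<) ◅ ε
  ▷-step {u} {u′} {w} ok u▷u′ (bwd e) = go ok u▷u′ (view e)
    where
    go : ∀ {u u′ w} → HasIn E′ u′ ⊎ ¬ Z′ u′ → u ▷ u′ → ArcView w u → ∃ λ w′ → w ▷ w′ × u′ ~′ w′
    go ok (kept s≡ _) (plain r≡ s≡′ _ e′) with refl ← σ-injective (trans (sym s≡) s≡′) =
      _ , kept r≡ (proj₁ e′) , bwd e′ ◅ ε
    go ok (kept s≡ _) (enter _ s≡′ _ _) = contradiction (trans (sym s≡) s≡′) σ≢p
    go (inj₁ ((i , t) , e′@(t< , next≡ , eq , _))) (kept s≡ _) (leave r≡ s≡′ j≡ j<)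
      with refl ← σ-injective (trans (sym s≡) s≡′)
      with refl ← next′-injective q-size t< next≡ =
      _ , crossed r≡ refl (trans j≡ (sym eq)) j< , bwd e′ ◅ ε
    go {w = j , _} (inj₂ ¬zeroed) (kept s≡ _) (leave r≡ s≡′ j≡ j<)
      with refl ← σ-injective (trans (sym s≡) s≡′)
      with up′ q ≤? j
    ... | no  up≰j = contradiction
      (head q-size refl (subst (_< m) j≡ j<) (subst (_< up′ q) j≡ (≰⇒> up≰j))) ¬zeroed
    ... | yes up≤j = let up+ = m+[n∸m]≡n up≤j in
      (j ∸ up′ q , q) , crossed r≡ refl (sym up+) j<
      , bwd (q-size , refl , trans up+ j≡ , subst (_< m) (sym up+) j<) ◅ ε
    go ok (crossed s≡ _ _ _) (plain _ s≡′ _ _) = contradiction (trans (sym s≡′) s≡) σ≢p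
    go ok (crossed _ refl j≡ _) (enter r≡ _ j≡′ _)
      with refl ← +-cancelˡ-≡ (up′ q) _ _ (trans (sym j≡) j≡′) = _ , kept r≡ q-size , ε
    go ok (crossed s≡ _ _ _) (leave _ s≡′ _ _) = contradiction (trans (sym s≡′) s≡) σ≢p

  ▷-~ : ∀ {u u′ w} → (∀ {x} → u′ ~′ x → HasIn E′ x ⊎ ¬ Z′ x) → u ▷ u′ → u ~ w →
        ∃ λ w′ → w ▷ w′ × u′ ~′ w′
  ▷-~ ok u▷u′ ε = _ , u▷u′ , ε
  ▷-~ ok u▷u′ (e ◅ r) with ▷-step (ok ε) u▷u′ e
  ... | x′ , x▷x′ , u′~x′ with ▷-~ (λ x′~y → ok (u′~x′ ◅◅ x′~y)) x▷x′ r
  ...   | w′ , w▷w′ , x′~w′ = w′ , w▷w′ , u′~x′ ◅◅ x′~w′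

  F-▷ : ∀ {u′ w′} → F u′ ▷ w′ → u′ ≡ w′
  F-▷ (kept s≡ _)          = cong (_ ,_) (σ-injective s≡)
  F-▷ (crossed s≡ _ _ _) = contradiction s≡ σ≢p

  ▷-HasIn : ∀ {u u′} → u ▷ u′ → HasIn E′ u′ → HasIn E u
  ▷-HasIn (crossed refl refl j≡ j<) _ = _ , unview (enter refl refl j≡ j<)
  ▷-HasIn (kept refl _) ((i , t) , e′@(_ , refl , eq , <m)) with t ≟ q
  ... | no  t≢q  = _ , unview (plain refl refl t≢q e′)
  ... | yes refl = _ , unview (leave refl refl eq <m)

  ▷-HasOut : ∀ {u u′} → u ▷ u′ → HasOut E′ u′ → HasOut E u
  ▷-HasOut (crossed refl refl j≡ j<) (_ , _ , refl , eq , _) = _ , unview (leave refl refl (trans j≡ eq) j<)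
  ▷-HasOut {u′ = i , t} (kept refl _) (_ , e′@(_ , refl , _ , <m)) with t ≟ q
  ... | no  t≢q  = _ , unview (plain refl refl t≢q e′)
  ... | yes refl = _ , unview (enter refl refl refl <m)

  ▷-Zeroed : ∀ {u u′} → u ▷ u′ → Z u → Z′ u′
  ▷-Zeroed u▷u′ z = go u▷u′ (zeroedView z)
    where
    go : ∀ {u u′} → u ▷ u′ → ZeroedView u → Z′ u′
    go (kept s≡ _) (plain s≡′ z′) with refl ← σ-injective (trans (sym s≡) s≡′) = z′
    go (kept s≡ _) (gap s≡′ _ _) = contradiction (trans (sym s≡) s≡′) σ≢p
    go (crossed s≡ _ _ _) (plain s≡′ _) = contradiction (trans (sym s≡′) s≡) σ≢p
    go (crossed _ refl refl _)  (gap _ _ (inj₁ <up))   = contradiction <up (m+n≮m _ _)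
    go (crossed _ refl refl j<) (gap _ _ (inj₂ <down)) = tail q-size j< <down

  -- A `leave` arc into `F u′` alone proves nothing, since its tail `(j , p)` may have `j < up′ q`.
  -- The assumption covers the whole component, so an arc also enters `(j , p)`; it must be an
  -- `enter` arc, and the two together form the subdivided arc of `C′`.
  F-HasIn : ∀ {u′} → (∀ {x} → F u′ ~ x → HasIn E x) → HasIn E′ u′
  F-HasIn inn = go inn (view (proj₂ (inn ε)))
    where
    go : ∀ {u′ w} → (∀ {x} → F u′ ~ x → HasIn E x) → ArcView w (F u′) → HasIn E′ u′
    go inn (plain _ s≡ _ e′) with refl ← σ-injective s≡ = _ , e′
    go inn (enter _ s≡ _ _)  = contradiction s≡ σ≢p
    go inn (leave refl s≡ j≡ j<) with refl ← σ-injective s≡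
      with view (proj₂ (inn (bwd (unview (leave refl refl j≡ j<)) ◅ ε)))
    ... | plain _ p≡ _ _  = contradiction (sym p≡) σ≢p
    ... | enter _ _ j≡′ _ = _ , q-size , refl , trans (sym j≡′) j≡ , subst (_< m) j≡′ j<
    ... | leave _ p≡ _ _  = contradiction (sym p≡) σ≢p

  F-HasOut : ∀ {u′} → (∀ {x} → F u′ ~ x → HasOut E x) → HasOut E′ u′
  F-HasOut out = go out (view (proj₂ (out ε)))
    where
    go : ∀ {u′ w} → (∀ {x} → F u′ ~ x → HasOut E x) → ArcView (F u′) w → HasOut E′ u′
    go out (plain s≡ _ _ e′) with refl ← σ-injective s≡ = _ , e′
    go out (leave s≡ _ _ _)  = contradiction s≡ σ≢p
    go out (enter s≡ refl j≡ j<) with refl ← σ-injective s≡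
      with view (proj₂ (out (fwd (unview (enter refl refl j≡ j<)) ◅ ε)))
    ... | plain p≡ _ _ _  = contradiction (sym p≡) σ≢p
    ... | enter p≡ _ _ _  = contradiction (sym p≡) σ≢p
    ... | leave _ _ j≡′ _ = _ , q-size , refl , trans (sym j≡) j≡′ , subst (_< m) j≡ j<

  -- The marks produced by the rule at `q` do not stay in place: since `down (σ q)` and `up p`
  -- vanish, they reappear in column `p`, on a neighbour of `F u′`. Hence the conclusion speaks of
  -- the component.
  F-Zeroed : ∀ {u′} → Z′ u′ → ∃ λ u → F u′ ~ u × Z u
  F-Zeroed {i , t} (tail t< <m <down) with t ≟ q
  ... | no  t≢q  = _ , ε , tail (σ-size t<) (subst (λ a → a + i < m) (sym (up-σ t<)) <m)
    (subst₂ (λ a b → a + i < b) (sym (up-σ t<)) (sym (down-σ t< t≢q)) <down)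
  ... | yes refl = _ , fwd (unview (enter refl refl refl <m)) ◅ ε , gap-zeroed <m (inj₂ <down)
  F-Zeroed {i , _} (head {t = t} t< refl <m <up) with t ≟ q
  ... | no  t≢q  = _ , ε , head (σ-size t<) (sym (next-σ t< t≢q))
    (subst (λ b → b + i < m) (sym (down-σ t< t≢q)) <m)
    (subst₂ (λ b a → b + i < a) (sym (down-σ t< t≢q)) (sym (up-σ t<)) <up)
  ... | yes refl = _ , bwd (unview (leave refl refl refl <m)) ◅ ε , gap-zeroed <m (inj₁ <up)

  -- A new entering arc can only come from some `(j , p)` with `j < up′ q`, and exactly then `u′`
  -- was zeroed as a `head`.
  F-source : ∀ {u′} → ¬ Z′ u′ → ¬ HasIn E′ u′ → ¬ HasIn E (F u′)
  F-source ¬zeroed ¬in (w , e) = go ¬zeroed ¬in (view e)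
    where
    go : ∀ {u′ w} → ¬ Z′ u′ → ¬ HasIn E′ u′ → ¬ ArcView w (F u′)
    go ¬zeroed ¬in (plain _ s≡ _ e′) with refl ← σ-injective s≡ = ¬in (_ , e′)
    go ¬zeroed ¬in (enter _ s≡ _ _)  = σ≢p s≡
    go ¬zeroed ¬in (leave {j = j} refl s≡ j≡ j<) with refl ← σ-injective s≡ with up′ q ≤? j
    ... | no  up≰j = ¬zeroed (head q-size refl (subst (_< m) j≡ j<) (subst (_< up′ q) j≡ (≰⇒> up≰j)))
    ... | yes up≤j = let up+ = m+[n∸m]≡n up≤j in
      ¬in (_ , q-size , refl , trans up+ j≡ , subst (_< m) (sym up+) j<)

  -- Only the vertices of column `p` lower than `up′ q` have no image. They are zeroed, and no arc
  -- enters them.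
  project : ∀ {i s} → i < m → s < size → HasIn E (i , s) ⊎ ¬ Z (i , s) → ∃ λ v′ → (i , s) ▷ v′
  project {i} i<m s< ok with σ-or-p s<
  ... | inj₂ (t , s≡ , t<) = _ , kept s≡ t<
  project i<m s< (inj₁ (_ , e)) | inj₁ refl with view e
  ... | plain _ p≡ _ _  = contradiction (sym p≡) σ≢p
  ... | enter _ _ j≡ j< = _ , crossed refl refl j≡ j<
  ... | leave _ p≡ _ _  = contradiction (sym p≡) σ≢p
  project {i} i<m s< (inj₂ ¬zeroed) | inj₁ refl with up′ q ≤? i
  ... | yes up≤i = (i ∸ up′ q , q) , crossed refl refl (sym (m+[n∸m]≡n up≤i)) i<m
  ... | no  up≰i = contradiction (gap-zeroed i<m (inj₁ (≰⇒> up≰i))) ¬zeroed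

  Circular-F : ∀ {v′} → v′ .proj₂ < size′ → Circular E′ v′ → Circular E (F v′)
  Circular-F v′< circ F~u with ▷-~ (λ v′~x → inj₁ (proj₂ (circ v′~x))) (kept refl v′<) F~u
  ... | u′ , u▷u′ , v′~u′ = let out , inn = circ v′~u′ in ▷-HasOut u▷u′ out , ▷-HasIn u▷u′ inn

  FreeLinear-F : ∀ {v′} → v′ .proj₂ < size′ → FreeLinear E′ Z′ v′ → FreeLinear E Z (F v′)
  FreeLinear-F v′< (free , u′ , v′~u′ , ¬in) =
    unmarked , F u′ , F-~ v′~u′ , F-source (free v′~u′) ¬in
    where
    unmarked : ∀ {u} → F _ ~ u → ¬ Z u
    unmarked F~u z with ▷-~ (λ v′~x → inj₂ (free v′~x)) (kept refl v′<) F~u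
    ... | _ , u▷u′ , v′~u′ = free v′~u′ (▷-Zeroed u▷u′ z)

  Circular-▷ : ∀ {v v′} → v ▷ v′ → Circular E v → Circular E′ v′
  Circular-▷ v▷v′ circ v′~u′ =
    let v~F = ▷-F v▷v′ ◅◅ F-~ v′~u′ in
    F-HasOut (λ F~x → proj₁ (circ (v~F ◅◅ F~x))) , F-HasIn (λ F~x → proj₂ (circ (v~F ◅◅ F~x)))

  FreeLinear-▷ : ∀ {v v′} → v ▷ v′ → FreeLinear E Z v → FreeLinear E′ Z′ v′
  FreeLinear-▷ {v} {v′} v▷v′ (free , u , v~u , ¬in) =
    let u′ , u▷u′ , v′~u′ = ▷-~ (inj₂ ∘ free′) v▷v′ v~u in
    free′ , u′ , v′~u′ , ¬in ∘ ▷-HasIn u▷u′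
    where
    free′ : ∀ {u′} → v′ ~′ u′ → ¬ Z′ u′
    free′ v′~u′ z with F-Zeroed z
    ... | _ , F~x , zx = free (▷-F v▷v′ ◅◅ F-~ v′~u′ ◅◅ F~x) zx

  F-reflects : ∀ {u′ v′} → u′ .proj₂ < size′ → (∀ {x} → u′ ~′ x → HasIn E′ x ⊎ ¬ Z′ x) →
               F u′ ~ F v′ → u′ ~′ v′
  F-reflects u′< ok F~F with ▷-~ ok (kept refl u′<) F~F
  ... | w′ , F▷w′ , u′~w′ with refl ← F-▷ F▷w′ = u′~w′

  ▷-reflects : ∀ {u v u′ v′} → u ▷ u′ → v ▷ v′ → u′ ~′ v′ → u ~ v
  ▷-reflects u▷u′ v▷v′ u′~v′ = ▷-F u▷u′ ◅◅ F-~ u′~v′ ◅◅ symmetric E (▷-F v▷v′)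

-- The digraph of a circular sequence

-- The modulus `suc (s ∸ 1)` is `s` for positive `s`, in a form visibly nonzero and definitionally
-- the one used by `edgeAt` and `markAt`.
cyclicSuc : ℕ → ℕ → ℕ
cyclicSuc s t = suc t % suc (s ∸ 1)

columns : List ℤ → Columns
columns xs = record
  { size = length xs
  ; next = cyclicSuc (length xs)
  ; up   = λ t → pos (at xs t)
  ; down = λ t → neg (at xs (suc t))
  }

-- Γ by the rules for s ≥ 2, applied at length 1 as well, where Γ follows a different rule.
wheel : ℕ → List ℤ → Digraph
wheel m xs = record
  { vertices = allVertices m (length xs)
  ; edges    = concatMap (λ t → concatMap (edgeAt xs t) (upTo m)) (upTo (length xs))
  ; marked   = concatMap (λ t → concatMap (markAt xs t) (upTo m)) (upTo (length xs))
  }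

cyclicSuc-suc : ∀ {s t} → suc t < s → cyclicSuc s t ≡ suc t
cyclicSuc-suc {suc s} t+1<s = m<n⇒m%n≡m t+1<s

cyclicSuc-last : ∀ t → cyclicSuc (suc t) t ≡ 0
cyclicSuc-last t = n%n≡0 (suc t)

cyclicSuc-< : ∀ {s t} → t < s → cyclicSuc s t < s
cyclicSuc-< {suc s} {t} _ = m%n<n (suc t) (suc s)

cyclicSuc-injective : ∀ {s t u} → t < s → u < s → cyclicSuc s t ≡ cyclicSuc s u → t ≡ u
cyclicSuc-injective {s} {t} {u} t<s u<s eq with m≤n⇒m<n∨m≡n t<s | m≤n⇒m<n∨m≡n u<s
... | inj₁ t+1<s | inj₁ u+1<s =
  suc-injective (trans (sym (cyclicSuc-suc t+1<s)) (trans eq (cyclicSuc-suc u+1<s)))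
... | inj₂ refl  | inj₂ refl  = refl
... | inj₁ t+1<s | inj₂ refl  =
  contradiction (trans (sym (cyclicSuc-suc t+1<s)) (trans eq (cyclicSuc-last u))) 1+n≢0
... | inj₂ refl  | inj₁ u+1<s =
  contradiction (trans (sym (cyclicSuc-suc u+1<s)) (trans (sym eq) (cyclicSuc-last t))) 1+n≢0

∈-allVertices⁻ : ∀ m s {i t} → (i , t) ∈ allVertices m s → i < m × t < s
∈-allVertices⁻ m s v∈
  with i , i∈ , v∈′ ← find (∈-concatMap⁻ (λ i → map (i ,_) (upTo s)) {xs = upTo m} v∈)
  with t , t∈ , refl ← ∈-map⁻ (i ,_) v∈′ = ∈-upTo⁻ i∈ , ∈-upTo⁻ t∈

∈-allVertices⁺ : ∀ {m s i t} → i < m → t < s → (i , t) ∈ allVertices m s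
∈-allVertices⁺ {m} {s} {i} i<m t<s =
  ∈-concatMap⁺ (λ i → map (i ,_) (upTo s)) (lose (∈-upTo⁺ i<m) (∈-map⁺ (i ,_) (∈-upTo⁺ t<s)))

module _ {A B : Set} {R : Rel B 0ℓ} (f : A → List B) where

  concatMap-AllPairs : ∀ {xs} → (∀ x → AllPairs R (f x)) →
    AllPairs (λ x y → ∀ {a b} → a ∈ f x → b ∈ f y → R a b) xs → AllPairs R (concatMap f xs)
  concatMap-AllPairs within across = AllPairs.concat⁺
    (All.map⁺ (All.tabulate (λ {x} _ → within x)))
    (AllPairs.map⁺ (AllPairs.map (λ r → All.tabulate (λ a∈ → All.tabulate (λ b∈ → r a∈ b∈))) across))

if-AllPairs : ∀ {B : Set} {R : Rel B 0ℓ} b {x} → AllPairs R (if b then x ∷ [] else [])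
if-AllPairs true  = [] ∷ []
if-AllPairs false = []

module _ (m : ℕ) (xs : List ℤ) where
  open Columns (columns xs)

  private
    edgesAt : ℕ → List Edge
    edgesAt t = concatMap (edgeAt xs t) (upTo m)

  edgeAt⁻ : ∀ {t j e} → e ∈ edgeAt xs t j →
            up t ≤ j × down t ≤ j × source e ≡ (j ∸ up t , t) × target e ≡ (j ∸ down t , next t)
  edgeAt⁻ {t} {j} e∈ with ok , refl ← ∈-if⁻ ((up t ≤ᵇ j) ∧ (down t ≤ᵇ j)) e∈
    with up≤ , down≤ ← to (T-∧ {up t ≤ᵇ j}) ok = ≤ᵇ⇒≤ _ _ up≤ , ≤ᵇ⇒≤ _ _ down≤ , refl , refl

  edgesAt⁻ : ∀ {t e} → e ∈ edgesAt t → ∃ λ j → j < m × e ∈ edgeAt xs t j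
  edgesAt⁻ {t} e∈ with j , j∈ , e∈′ ← find (∈-concatMap⁻ (edgeAt xs t) {xs = upTo m} e∈) =
    j , ∈-upTo⁻ j∈ , e∈′

  edgesAt-source : ∀ {t e} → e ∈ edgesAt t → proj₂ (source e) ≡ t
  edgesAt-source e∈ with _ , _ , e∈′ ← edgesAt⁻ e∈ with _ , _ , refl , _ ← edgeAt⁻ e∈′ = refl

  edgesAt-target : ∀ {t e} → e ∈ edgesAt t → proj₂ (target e) ≡ next t
  edgesAt-target e∈ with _ , _ , e∈′ ← edgesAt⁻ e∈ with _ , _ , _ , refl ← edgeAt⁻ e∈′ = refl

  edge⇒Arc : ∀ {u v w} → (u , v , w) ∈ edges (wheel m xs) → Arc m (columns xs) u v
  edge⇒Arc e∈
    with t , t∈ , e∈t ← find (∈-concatMap⁻ edgesAt {xs = upTo (length xs)} e∈)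
    with j , j<m , e∈j ← edgesAt⁻ {t} e∈t
    with up≤ , down≤ , refl , refl ← edgeAt⁻ {t} {j} e∈j =
    ∈-upTo⁻ t∈ , refl , trans (m+[n∸m]≡n up≤) (sym (m+[n∸m]≡n down≤)) , subst (_< m) (sym (m+[n∸m]≡n up≤)) j<m

  Arc⇒edge : ∀ {u v} → Arc m (columns xs) u v → ∃ λ w → (u , v , w) ∈ edges (wheel m xs)
  Arc⇒edge {i , t} {k , _} (t< , refl , eq , <m) =
    _ , ∈-concatMap⁺ edgesAt (lose (∈-upTo⁺ t<) (∈-concatMap⁺ (edgeAt xs t) (lose (∈-upTo⁺ <m)
      (∈-if⁺ (from T-∧ (≤⇒≤ᵇ (m≤m+n (up t) i) , ≤⇒≤ᵇ (m+n≤o⇒m≤o (down t) (≤-reflexive (sym eq)))))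
        (cong₂ _,_ (cong (_, t) (sym (m+n∸m≡n (up t) i)))
          (cong₂ _,_ (cong (_, next t) (sym (trans (cong (_∸ down t) eq) (m+n∸m≡n (down t) k)))) refl))))))

  marked⇒Zeroed : ∀ {v} → v ∈ marked (wheel m xs) → Zeroed m (columns xs) v
  marked⇒Zeroed v∈
    with t , t∈ , v∈t ← find (∈-concatMap⁻ (λ t → concatMap (markAt xs t) (upTo m)) {xs = upTo (length xs)} v∈)
    with j , j∈ , v∈j ← find (∈-concatMap⁻ (markAt xs t) {xs = upTo m} v∈t)
    with ∈-++⁻ (if (up t ≤ᵇ j) ∧ (j <ᵇ down t) then (j ∸ up t , t) ∷ [] else []) v∈j
  ... | inj₁ h with ok , refl ← ∈-if⁻ ((up t ≤ᵇ j) ∧ (j <ᵇ down t)) h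
    with up≤ , <down ← to (T-∧ {up t ≤ᵇ j}) ok
    with up+ ← sym (m+[n∸m]≡n (≤ᵇ⇒≤ (up t) j up≤)) =
    tail (∈-upTo⁻ t∈) (subst (_< m) up+ (∈-upTo⁻ j∈)) (subst (_< down t) up+ (<ᵇ⇒< j (down t) <down))
  ... | inj₂ h with ok , refl ← ∈-if⁻ ((down t ≤ᵇ j) ∧ (j <ᵇ up t)) h
    with down≤ , <up ← to (T-∧ {down t ≤ᵇ j}) ok
    with down+ ← sym (m+[n∸m]≡n (≤ᵇ⇒≤ (down t) j down≤)) =
    head (∈-upTo⁻ t∈) refl (subst (_< m) down+ (∈-upTo⁻ j∈)) (subst (_< up t) down+ (<ᵇ⇒< j (up t) <up))

  Zeroed⇒marked : ∀ {v} → Zeroed m (columns xs) v → v ∈ marked (wheel m xs)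
  Zeroed⇒marked (tail {i} {t} t< <m <down) =
    ∈-concatMap⁺ _ (lose (∈-upTo⁺ t<) (∈-concatMap⁺ (markAt xs t) (lose (∈-upTo⁺ <m) (∈-++⁺ˡ
      (∈-if⁺ (from T-∧ (≤⇒≤ᵇ (m≤m+n (up t) i) , <⇒<ᵇ <down)) (cong (_, t) (sym (m+n∸m≡n (up t) i))))))))
  Zeroed⇒marked (head {k} {t} t< refl <m <up) =
    ∈-concatMap⁺ _ (lose (∈-upTo⁺ t<) (∈-concatMap⁺ (markAt xs t) (lose (∈-upTo⁺ <m) (∈-++⁺ʳ _
      (∈-if⁺ (from T-∧ (≤⇒≤ᵇ (m≤m+n (down t) k) , <⇒<ᵇ <up)) (cong (_, next t) (sym (m+n∸m≡n (down t) k))))))))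

  wheel-presents : Presents (wheel m xs) (Arc m (columns xs)) (Zeroed m (columns xs))
  wheel-presents = record
    { edge⁺    = Arc⇒edge
    ; edge⁻    = edge⇒Arc
    ; marked⁺  = Zeroed⇒marked
    ; marked⁻  = marked⇒Zeroed
    ; source∈  = λ { {_ , t} (t< , _ , _ , <m) → ∈-allVertices⁺ (≤-<-trans (m≤n+m _ (up t)) <m) t< }
    ; target∈  = λ { {_ , t} (t< , refl , eq , <m) →
                     ∈-allVertices⁺ (≤-<-trans (m≤n+m _ (down t)) (subst (_< m) eq <m)) (cyclicSuc-< t<) }
    -- Within a column, subtracting `up t` is injective on the admissible `j`; edges of different
    -- columns differ in the second coordinate of the source.
    ; sources! = concatMap-AllPairs edgesAt
        (λ t → concatMap-AllPairs (edgeAt xs t) (λ j → if-AllPairs ((up t ≤ᵇ j) ∧ (down t ≤ᵇ j)))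
          (AllPairs.applyUpTo⁺₁ id m (λ i<j _ a∈ b∈ a≡b →
            let up≤i , _ , a≡ , _ = edgeAt⁻ a∈
                up≤j , _ , b≡ , _ = edgeAt⁻ b∈
            in <⇒≢ i<j (∸-cancelʳ-≡ up≤i up≤j (,-injectiveˡ (trans (sym a≡) (trans a≡b b≡)))))))
        (AllPairs.applyUpTo⁺₁ id (length xs) (λ t<u _ a∈ b∈ a≡b →
          <⇒≢ t<u (trans (sym (edgesAt-source a∈)) (trans (cong proj₂ a≡b) (edgesAt-source b∈)))))
    -- For targets, different columns are told apart by the injectivity of the cyclic successor.
    ; targets! = concatMap-AllPairs edgesAt
        (λ t → concatMap-AllPairs (edgeAt xs t) (λ j → if-AllPairs ((up t ≤ᵇ j) ∧ (down t ≤ᵇ j)))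
          (AllPairs.applyUpTo⁺₁ id m (λ i<j _ a∈ b∈ a≡b →
            let _ , down≤i , _ , a≡ = edgeAt⁻ a∈
                _ , down≤j , _ , b≡ = edgeAt⁻ b∈
            in <⇒≢ i<j (∸-cancelʳ-≡ down≤i down≤j (,-injectiveˡ (trans (sym a≡) (trans a≡b b≡)))))))
        (AllPairs.applyUpTo⁺₁ id (length xs) (λ t<u u<s a∈ b∈ a≡b →
          <⇒≢ t<u (cyclicSuc-injective (<-trans t<u u<s) u<s
            (trans (sym (edgesAt-target a∈)) (trans (cong proj₂ a≡b) (edgesAt-target b∈))))))
    }

-- Positions in a cyclic list after inserting an entry

skip : ℕ → ℕ → ℕ
skip zero    t       = suc t
skip (suc p) zero    = zero
skip (suc p) (suc t) = suc (skip p t)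

skip-injective : ∀ p {t u} → skip p t ≡ skip p u → t ≡ u
skip-injective zero    refl = refl
skip-injective (suc p) {zero}  {zero}  _  = refl
skip-injective (suc p) {suc t} {suc u} eq = cong suc (skip-injective p (suc-injective eq))

skip≢ : ∀ p {t} → skip p t ≢ p
skip≢ (suc p) {suc t} eq = skip≢ p (suc-injective eq)

skip-below : ∀ {p t} → t < p → skip p t ≡ t
skip-below {suc p} {zero}  _         = refl
skip-below {suc p} {suc t} (s≤s t<p) = cong suc (skip-below t<p)

skip-above : ∀ {p t} → p ≤ t → skip p t ≡ suc t
skip-above {zero}          _         = refl
skip-above {suc p} {suc t} (s≤s p≤t) = cong suc (skip-above p≤t)

skip-< : ∀ p {s t} → t < s → skip p t < suc s
skip-< zero    t<s = s<s t<s
skip-< (suc p) {suc s} {zero}  _         = s≤s z≤n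
skip-< (suc p) {suc s} {suc t} (s≤s t<s) = s<s (skip-< p t<s)

skip-onto : ∀ {p s t} → p ≤ s → t < suc s → t ≡ p ⊎ ∃ λ t′ → t ≡ skip p t′ × t′ < s
skip-onto {zero}  {t = zero}  _ _         = inj₁ refl
skip-onto {zero}  {t = suc t} _ (s≤s t<s) = inj₂ (t , refl , t<s)
skip-onto {suc p} {suc s} {zero}  _         _         = inj₂ (zero , refl , s≤s z≤n)
skip-onto {suc p} {suc s} {suc t} (s≤s p≤s) (s≤s t<s) with skip-onto p≤s t<s
... | inj₁ refl              = inj₁ refl
... | inj₂ (t′ , refl , t′<) = inj₂ (suc t′ , refl , s<s t′<)

-- Inserting at the front means, cyclically, inserting after the last of the `s` entries; `p` ranges
-- up to `s` inclusive, the value `s` being insertion at the end.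
cyclicPred : ℕ → ℕ → ℕ
cyclicPred s zero    = s ∸ 1
cyclicPred s (suc p) = p

cyclicPred-< : ∀ {s p} → 1 ≤ s → p ≤ s → cyclicPred s p < s
cyclicPred-< {suc s} {zero}  _ _   = ≤-refl
cyclicPred-< {suc s} {suc p} _ p≤s = p≤s

cyclicSuc-skip : ∀ {s p t} → p ≤ s → t < s → t ≢ cyclicPred s p →
                 cyclicSuc (suc s) (skip p t) ≡ skip p (cyclicSuc s t)
cyclicSuc-skip {s} {p} {t} p≤s t<s t≢q with <-cmp (suc t) p
... | tri< t+1<p _ _
  rewrite skip-below (<-trans (n<1+n t) t+1<p) | cyclicSuc-suc (s<s t<s)
        | cyclicSuc-suc (<-≤-trans t+1<p p≤s) = sym (skip-below t+1<p)
... | tri≈ _ refl _ = contradiction refl t≢q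
... | tri> _ _ (s≤s p≤t) rewrite skip-above p≤t with m≤n⇒m<n∨m≡n t<s
...   | inj₁ t+1<s rewrite cyclicSuc-suc (s<s t+1<s) | cyclicSuc-suc t+1<s = sym (skip-above (m≤n⇒m≤1+n p≤t))
-- Both successors wrap around to `0`, and `skip p 0` is `0` unless `p` is `0`; in that case the
-- last column is the excluded predecessor.
...   | inj₂ refl rewrite cyclicSuc-last (suc t) | cyclicSuc-last t with p
...     | zero  = contradiction refl t≢q
...     | suc _ = refl

cyclicSuc-skip-pred : ∀ {s p} → 1 ≤ s → p ≤ s → cyclicSuc (suc s) (skip p (cyclicPred s p)) ≡ p
cyclicSuc-skip-pred {suc s} {zero}  _ _   = cyclicSuc-last (suc s)
cyclicSuc-skip-pred {suc s} {suc p} _ p≤s rewrite skip-below (n<1+n p) = cyclicSuc-suc (s≤s p≤s)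

cyclicSuc-inserted : ∀ {s p} → 1 ≤ s → p ≤ s →
                     cyclicSuc (suc s) p ≡ skip p (cyclicSuc s (cyclicPred s p))
cyclicSuc-inserted {suc s} {zero}  _ _ rewrite cyclicSuc-last s = cyclicSuc-suc {suc (suc s)} (s≤s (s≤s z≤n))
cyclicSuc-inserted {suc s} {suc p} _ p<s with m≤n⇒m<n∨m≡n p<s
... | inj₁ p+1<s rewrite cyclicSuc-suc p+1<s | skip-above (≤-refl {p}) = cyclicSuc-suc (s<s p+1<s)
... | inj₂ refl  rewrite cyclicSuc-last s = cyclicSuc-last (suc s)

at-< : ∀ xs {t} → t < length xs → at xs t ≡ entry xs t
at-< (x ∷ xs) t< = cong (entry (x ∷ xs)) (m<n⇒m%n≡m t<)

at-suc : ∀ xs t → at xs (suc t) ≡ entry xs (cyclicSuc (length xs) t)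
at-suc []       t = refl
at-suc (x ∷ xs) t = refl

entry-length : ∀ xs {z ys} → entry (xs ++ z ∷ ys) (length xs) ≡ z
entry-length []       = refl
entry-length (x ∷ xs) = entry-length xs

entry-skip : ∀ xs {z ys} t → entry (xs ++ z ∷ ys) (skip (length xs) t) ≡ entry (xs ++ ys) t
entry-skip []       t       = refl
entry-skip (x ∷ xs) zero    = refl
entry-skip (x ∷ xs) (suc t) = entry-skip xs t

zero-insertion : ∀ xs ys → 1 ≤ length (xs ++ ys) →
                 Insertion (columns (xs ++ + 0 ∷ ys)) (columns (xs ++ ys))
zero-insertion xs ys 1≤ = record
  { σ               = skip p
  ; p               = p
  ; q               = q
  ; σ-injective     = skip-injective p
  ; σ≢p             = skip≢ p
  ; σ-size          = σ-size
  ; p-size          = p-size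
  ; q-size          = q-size
  ; σ-or-p          = λ t< → skip-onto p≤ (subst (_ <_) size≡ t<)
  ; next′-size      = cyclicSuc-<
  ; next′-injective = cyclicSuc-injective
  ; next-σ          = next-σ
  ; next-σq         = next-σq
  ; next-p          = next-p
  ; up-σ            = λ {t} t< → cong pos (trans (at-< zs (σ-size t<))
                        (trans (entry-skip xs t) (sym (at-< (xs ++ ys) t<))))
  ; up-p            = cong pos (trans (at-< zs p-size) (entry-length xs))
  ; down-σ          = λ {t} t< t≢q → cong neg (trans (at-suc zs (skip p t))
                        (trans (cong (entry zs) (next-σ t< t≢q)) (skipped t)))
  ; down-σq         = cong neg (trans (at-suc zs (skip p q))
                        (trans (cong (entry zs) next-σq) (entry-length xs)))
  ; down-p          = cong neg (trans (at-suc zs p) (trans (cong (entry zs) next-p) (skipped q)))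
  }
  where
  zs : List ℤ
  zs = xs ++ + 0 ∷ ys

  s p q : ℕ
  s = length (xs ++ ys)
  p = length xs
  q = cyclicPred s p

  size≡ : length zs ≡ suc s
  size≡ = length-++-sucʳ xs (+ 0) ys

  p≤ : p ≤ s
  p≤ = subst (p ≤_) (sym (length-++ xs)) (m≤m+n p (length ys))

  p-size : p < length zs
  p-size = subst (p <_) (sym size≡) (s≤s p≤)

  q-size : q < s
  q-size = cyclicPred-< 1≤ p≤

  σ-size : ∀ {t} → t < s → skip p t < length zs
  σ-size t< = subst (skip p _ <_) (sym size≡) (skip-< p t<)

  next-σ : ∀ {t} → t < s → t ≢ q → cyclicSuc (length zs) (skip p t) ≡ skip p (cyclicSuc s t)
  next-σ t< t≢q rewrite size≡ = cyclicSuc-skip p≤ t< t≢q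

  next-σq : cyclicSuc (length zs) (skip p q) ≡ p
  next-σq rewrite size≡ = cyclicSuc-skip-pred 1≤ p≤

  next-p : cyclicSuc (length zs) p ≡ skip p (cyclicSuc s q)
  next-p rewrite size≡ = cyclicSuc-inserted 1≤ p≤

  skipped : ∀ t → entry zs (skip p (cyclicSuc s t)) ≡ at (xs ++ ys) (suc t)
  skipped t = trans (entry-skip xs (cyclicSuc s t)) (sym (at-suc (xs ++ ys) t))

-- Invariance of both counts under removal of zeros

_≈_ : Rel Digraph 0ℓ
G ≈ H = c G ≡ c H × ℓ G ≡ ℓ H

≈-trans : ∀ {G H K} → G ≈ H → H ≈ K → G ≈ K
≈-trans (c≡ , ℓ≡) (c≡′ , ℓ≡′) = trans c≡ c≡′ , trans ℓ≡ ℓ≡′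

≈-sym : ∀ {G H} → G ≈ H → H ≈ G
≈-sym (c≡ , ℓ≡) = sym c≡ , sym ℓ≡

both-zero : ∀ {a b a′ b′ : ℕ} → a ≡ 0 × b ≡ 0 → a′ ≡ 0 × b′ ≡ 0 → a ≡ a′ × b ≡ b′
both-zero (refl , refl) (refl , refl) = refl , refl

module _ (m : ℕ) (xs ys : List ℤ) (1≤ : 1 ≤ length (xs ++ ys)) where

  private
    zs : List ℤ
    zs = xs ++ + 0 ∷ ys

    C C′ : Columns
    C  = columns zs
    C′ = columns (xs ++ ys)

    ins : Insertion C C′
    ins = zero-insertion xs ys 1≤
    open Insertion ins

    G G′ : Digraph
    G  = wheel m zs
    G′ = wheel m (xs ++ ys)

    pres : Presents G (Arc m C) (Zeroed m C)
    pres = wheel-presents m zs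

    pres′ : Presents G′ (Arc m C′) (Zeroed m C′)
    pres′ = wheel-presents m (xs ++ ys)

    _↝_ : Rel Vertex 0ℓ
    (i , t) ↝ v = t < length (xs ++ ys) × v ≡ (i , σ t)

    -- What the two kinds of component have in common at each of their vertices, and all that
    -- `project` and `F-reflects` ask of them.
    Mid Mid′ : Vertex → Set
    Mid  v = HasIn (Arc m C) v ⊎ ¬ Zeroed m C v
    Mid′ v = HasIn (Arc m C′) v ⊎ ¬ Zeroed m C′ v

    ▷-vertex : ∀ {v v′} → v ∈ vertices G → _▷_ m ins v v′ → v′ ∈ vertices G′
    ▷-vertex v∈ (kept _ t<) = ∈-allVertices⁺ (proj₁ (∈-allVertices⁻ m (length zs) v∈)) t<
    ▷-vertex v∈ (crossed _ refl refl j<) = ∈-allVertices⁺ (≤-<-trans (m≤n+m _ (Columns.up C′ q)) j<) q-size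

    counts-agree : {p p′ : Vertex → Bool} {P P′ : Vertex → Set} →
      (∀ {v} → v ∈ vertices G → T (p v) ⇔ P v) →
      (∀ {v} → v ∈ vertices G′ → T (p′ v) ⇔ P′ v) →
      (∀ {u v} → EqClosure (Arc m C) u v → P u → P v) →
      (∀ {u v} → EqClosure (Arc m C′) u v → P′ u → P′ v) →
      (∀ {v} → P v → Mid v) →
      (∀ {v} → P′ v → Mid′ v) →
      (∀ {v v′} → _▷_ m ins v v′ → P v → P′ v′) →
      (∀ {i t} → t < length (xs ++ ys) → P′ (i , t) → P (i , σ t)) →
      count p (representatives G) ≡ count p′ (representatives G′)
    counts-agree {p} {p′} {P} {P′} p⇔P p′⇔P′ resp resp′ mid mid′ P⇒P′ P′⇒P = ≤-antisym
      (representatives-count-≤ pres pres′ p p′ P P′ (_▷_ m ins)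
        (to ∘ p⇔P) (from ∘ p′⇔P′) resp′ ▷-total (λ _ → ▷-reflects m ins))
      (representatives-count-≤ pres′ pres p′ p P′ P _↝_
        (to ∘ p′⇔P′) (from ∘ p⇔P) resp ↝-total
        -- `P′` is available at the second vertex only, so the path is reversed before it is
        -- transferred.
        (λ { P′v (_ , refl) (t< , refl) u~v → symmetric _
               (F-reflects m ins t< (λ v~x → mid′ (resp′ v~x P′v)) (symmetric _ u~v)) }))
      where
      ▷-total : ∀ {v} → v ∈ vertices G → P v → ∃ λ v′ → v′ ∈ vertices G′ × _▷_ m ins v v′ × P′ v′
      ▷-total v∈ Pv
        with i<m , s< ← ∈-allVertices⁻ m (length zs) v∈
        with v′ , v▷v′ ← project m ins i<m s< (mid Pv) = v′ , ▷-vertex v∈ v▷v′ , v▷v′ , P⇒P′ v▷v′ Pv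

      ↝-total : ∀ {v′} → v′ ∈ vertices G′ → P′ v′ → ∃ λ v → v ∈ vertices G × v′ ↝ v × P v
      ↝-total v′∈ P′v′ with i<m , t< ← ∈-allVertices⁻ m (length (xs ++ ys)) v′∈ =
        _ , ∈-allVertices⁺ i<m (σ-size t<) , (t< , refl) , P′⇒P t< P′v′

  insert-zero-≈ : wheel m (xs ++ + 0 ∷ ys) ≈ wheel m (xs ++ ys)
  insert-zero-≈ =
      counts-agree (isCircular⇔ pres) (isCircular⇔ pres′) Circular-resp Circular-resp
        (λ circ → inj₁ (proj₂ (circ ε))) (λ circ → inj₁ (proj₂ (circ ε)))
        (Circular-▷ m ins) (Circular-F m ins)
    , counts-agree (isFreeLinear⇔ pres) (isFreeLinear⇔ pres′) FreeLinear-resp FreeLinear-resp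
        (λ free → inj₂ (proj₁ free ε)) (λ free → inj₂ (proj₁ free ε))
        (FreeLinear-▷ m ins) (FreeLinear-F m ins)

HasNonzero : List ℤ → Set
HasNonzero = Any (λ e → T (nonzero e))

-- The prefix `xs` collects the entries already passed, so that a zero can be removed in the middle
-- of a list whose cyclic structure involves all of it. The nonzero entry keeps every shorter list
-- nonempty, which gives the removed column a predecessor.
removeZeros-≈ : ∀ m xs ys → HasNonzero (xs ++ ys) → wheel m (xs ++ ys) ≈ wheel m (xs ++ removeZeros ys)
removeZeros-≈ m xs []             _  = refl , refl
removeZeros-≈ m xs (+ zero ∷ ys)  nz =
  ≈-trans {wheel m (xs ++ + 0 ∷ ys)} {wheel m (xs ++ ys)} {wheel m (xs ++ removeZeros ys)}
    (insert-zero-≈ m xs ys (nonempty nz′)) (removeZeros-≈ m xs ys nz′)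
  where
  nz′ : HasNonzero (xs ++ ys)
  nz′ with Any.++⁻ xs nz
  ... | inj₁ nzˡ         = Any.++⁺ˡ nzˡ
  ... | inj₂ (there nzʳ) = Any.++⁺ʳ xs nzʳ

  nonempty : ∀ {zs} → HasNonzero zs → 1 ≤ length zs
  nonempty (here _)  = s≤s z≤n
  nonempty (there _) = s≤s z≤n
removeZeros-≈ m xs (+ suc n ∷ ys) nz =
  subst₂ (λ as bs → wheel m as ≈ wheel m bs) (∷ʳ-++ xs _ ys) (∷ʳ-++ xs _ (removeZeros ys))
    (removeZeros-≈ m (xs ∷ʳ + suc n) ys (subst HasNonzero (sym (∷ʳ-++ xs _ ys)) nz))
removeZeros-≈ m xs (-[1+ n ] ∷ ys) nz =
  subst₂ (λ as bs → wheel m as ≈ wheel m bs) (∷ʳ-++ xs _ ys) (∷ʳ-++ xs _ (removeZeros ys))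
    (removeZeros-≈ m (xs ∷ʳ -[1+ n ]) ys (subst HasNonzero (sym (∷ʳ-++ xs _ ys)) nz))

-- A single nonzero entry

module _ (m : ℕ) where

  private
    Inner : ℤ → Vertex → Set
    Inner e v = (HasOut (Arc m (columns (e ∷ []))) v × HasIn (Arc m (columns (e ∷ []))) v)
              ⊎ ¬ Zeroed m (columns (e ∷ [])) v

  -- Every arc changes the height by the value of the entry, so the lower neighbour is the
  -- predecessor for a positive entry and the successor for a negative one. It is missing only at
  -- heights below the absolute value of the entry, where the vertex is zeroed as a `head` or a
  -- `tail` respectively.
  descend : ∀ e → T (nonzero e) → ∀ {i t} → i < m → t < 1 → Inner e (i , t) →
            ∃ λ i′ → i′ < i × SymClosure (Arc m (columns (e ∷ []))) (i , t) (i′ , 0)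
  descend (+ suc a) _ i<m (s≤s z≤n) (inj₁ (_ , (i′ , 0) , e@(s≤s z≤n , _ , eq , _))) =
    i′ , subst (suc i′ ≤_) eq (s≤s (m≤n+m i′ a)) , bwd e
  descend (+ suc a) _ {i} i<m (s≤s z≤n) (inj₂ ¬zeroed) with suc a ≤? i
  ... | no  a≰i = contradiction (head (s≤s z≤n) refl i<m (≰⇒> a≰i)) ¬zeroed
  ... | yes a≤i = let a+ = m+[n∸m]≡n a≤i in
    i ∸ suc a , ∸-monoʳ-< (s≤s z≤n) a≤i , bwd (s≤s z≤n , refl , a+ , subst (_< m) (sym a+) i<m)
  descend -[1+ b ] _ i<m (s≤s z≤n) (inj₁ (((i′ , _) , e@(_ , refl , eq , _)) , _)) =
    i′ , subst (suc i′ ≤_) (sym eq) (s≤s (m≤n+m i′ b)) , fwd e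
  descend -[1+ b ] _ {i} i<m (s≤s z≤n) (inj₂ ¬zeroed) with suc b ≤? i
  ... | no  b≰i = contradiction (tail (s≤s z≤n) i<m (≰⇒> b≰i)) ¬zeroed
  ... | yes b≤i =
    i ∸ suc b , ∸-monoʳ-< (s≤s z≤n) b≤i , fwd (s≤s z≤n , refl , sym (m+[n∸m]≡n b≤i) , i<m)

  -- Infinite descent on the height, with `n` as the bound that makes the recursion structural.
  no-Inner-component : ∀ e → T (nonzero e) → ∀ n {i t} → i < n → i < m → t < 1 →
    ¬ (∀ {u} → EqClosure (Arc m (columns (e ∷ []))) (i , t) u → Inner e u)
  no-Inner-component e nz (suc n) (s≤s i≤n) i<m t<1 inner with descend e nz i<m t<1 (inner ε)
  ... | i′ , i′<i , v-v′ =
    no-Inner-component e nz n (<-≤-trans i′<i i≤n) (<-trans i′<i i<m) (s≤s z≤n) (λ r → inner (v-v′ ◅ r))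

  wheel-single : ∀ e → T (nonzero e) → c (wheel m (e ∷ [])) ≡ 0 × ℓ (wheel m (e ∷ [])) ≡ 0
  wheel-single e nz =
      representatives-count-0 pres _ (λ v∈ h → let circ = to (isCircular⇔ pres v∈) h in
        ¬inner v∈ (λ r → inj₁ (circ r)))
    , representatives-count-0 pres _ (λ v∈ h → let free = to (isFreeLinear⇔ pres v∈) h in
        ¬inner v∈ (λ r → inj₂ (proj₁ free r)))
    where
    pres : Presents (wheel m (e ∷ [])) (Arc m (columns (e ∷ []))) (Zeroed m (columns (e ∷ [])))
    pres = wheel-presents m (e ∷ [])

    ¬inner : ∀ {v} → v ∈ allVertices m 1 →
      ¬ (∀ {u} → EqClosure (Arc m (columns (e ∷ []))) v u → Inner e u)
    ¬inner v∈ with i<m , t<1 ← ∈-allVertices⁻ m 1 v∈ = no-Inner-component e nz m i<m i<m t<1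

  discrete : Digraph
  discrete = record { vertices = allVertices m 1 ; edges = [] ; marked = allVertices m 1 }

  discrete-counts : c discrete ≡ 0 × ℓ discrete ≡ 0
  discrete-counts =
      representatives-count-0 pres _ (λ v∈ h → proj₂ (proj₁ (to (isCircular⇔ pres v∈) h ε)))
    , representatives-count-0 pres _ (λ v∈ h → proj₁ (to (isFreeLinear⇔ pres v∈) h) ε v∈)
    where
    pres : Presents discrete (λ _ _ → ⊥) (_∈ allVertices m 1)
    pres = record
      { edge⁺ = λ () ; edge⁻ = λ () ; marked⁺ = id ; marked⁻ = id
      ; source∈ = λ () ; target∈ = λ () ; sources! = [] ; targets! = [] }

  Γ≈wheel : ∀ xs → HasNonzero xs → Γ m xs ≈ wheel m xs
  Γ≈wheel (_ ∷ _ ∷ _)     _ = refl , refl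
  Γ≈wheel (+ suc n ∷ [])  _ = both-zero discrete-counts (wheel-single (+ suc n) tt)
  Γ≈wheel (-[1+ n ] ∷ []) _ = both-zero discrete-counts (wheel-single -[1+ n ] tt)
  Γ≈wheel (+ zero ∷ [])   (here ())

removeZeros-HasNonzero : ∀ {xs} → HasNonzero xs → HasNonzero (removeZeros xs)
removeZeros-HasNonzero nz with x , x∈ , nzx ← find nz = lose (∈-filter⁺ (T? ∘ nonzero) x∈ nzx) nzx

theorem3p11 : (m : ℕ) → m ≥ 1 → (ε : List ℤ) → Any (λ e → T (nonzero e)) ε →
    (c (Γ m ε) ≡ c (Γ m (removeZeros ε))) × (ℓ (Γ m ε) ≡ ℓ (Γ m (removeZeros ε)))
theorem3p11 m _ xs nz =
  ≈-trans {Γ m xs} {wheel m xs} {Γ m (removeZeros xs)} (Γ≈wheel m xs nz)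
    (≈-trans {wheel m xs} {wheel m (removeZeros xs)} {Γ m (removeZeros xs)} (removeZeros-≈ m [] xs nz)
      (≈-sym {Γ m (removeZeros xs)} {wheel m (removeZeros xs)}
        (Γ≈wheel m (removeZeros xs) (removeZeros-HasNonzero nz))))
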